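{- Let $X$ be an apex-forest with at least two vertices, and let $G$ be a graph. If $G$ is $X$-minor-free, then $\operatorname{lpw}(G)\leq 2|V(X)|-3$.
   Context: All graphs are finite and simple. A graph is an apex-forest if it can be made acyclic by deleting at most one vertex. A model of $H$ in $G$ is a family $(B_x\mid x\in V(H))$ of pairwise disjoint subsets of $V(G)$ such that each $G[B_x]$ is non-empty and connected, and for every edge $xy\in E(H)$ there is an edge of $G$ between $B_x$ and $B_y$; $G$ is $H$-minor-free if it contains no model of $H$. A path decomposition of $G$ is a sequence $(W_1,\dots,W_m)$ ($m\ge 1$) of subsets of $V(G)$ (bags) such that every edge of $G$ has both ends in some bag and for each vertex $v$ the set $\{i: v\in W_i\}$ is a non-empty interval. A layering of $G$ is a sequence $(L_i\mid i\geq 0)$ of pairwise disjoint subsets of $V(G)$ with union $V(G)$ such that for every edge $uv$ there is $i\ge 0$ with $u,v\in L_i\cup L_{i+1}$. The layered pathwidth $\operatorname{lpw}(G)$ is the minimum, over all path decompositions $(W_1,\dots,W_m)$ and layerings $(L_i)$ of $G$, of $\max_{i,j}|W_i\cap L_j|$. -}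

module Defs where

open import Data.Nat using (ℕ; zero; suc; _+_; _*_; _∸_; _≤_; _<_)
open import Data.Fin using (Fin; toℕ; inject₁; fromℕ)
open import Data.Bool using (Bool; true; false; _∧_; _∨_)
open import Data.Maybe using (Maybe; just; nothing)
open import Data.Product using (Σ; ∃; _×_; _,_)
open import Relation.Binary.PropositionalEquality using (_≡_; _≢_)
open import Relation.Nullary using (¬_)
open import Function.Definitions using (Injective)

record Graph : Set where
  field
    n      : ℕ
    adj    : Fin n → Fin n → Bool
    sym    : ∀ u v → adj u v ≡ adj v u
    irrefl : ∀ u → adj u u ≡ false
open Graph public

V : Graph → Set
V G = Fin (n G)

Edge : (G : Graph) → V G → V G → Set
Edge G u v = adj G u v ≡ true

VSet : Graph → Set
VSet G = V G → Bool

_∈ˢ_ : {A : Set} → A → (A → Bool) → Set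
v ∈ˢ S = S v ≡ true

count : (k : ℕ) → (Fin k → Bool) → ℕ
count zero    P = 0
count (suc k) P with P Fin.zero
... | true  = suc (count k (λ i → P (Fin.suc i)))
... | false = count k (λ i → P (Fin.suc i))

∣_∣ˢ : {G : Graph} → VSet G → ℕ
∣_∣ˢ {G} S = count (n G) S

record Cycle (G : Graph) : Set where
  field
    len   : ℕ
    c     : Fin (3 + len) → V G
    inj   : Injective _≡_ _≡_ c
    consec : ∀ (i : Fin (2 + len)) → Edge G (c (inject₁ i)) (c (Fin.suc i))
    close : Edge G (c (fromℕ (2 + len))) (c Fin.zero)
open Cycle public

-- G − a is acyclic (a = nothing means no vertex is deleted):
-- no cycle of G avoids a.
AcyclicAfterDeleting : (G : Graph) → Maybe (V G) → Set
AcyclicAfterDeleting G a = ¬ (Σ (Cycle G) λ C → ∀ i → just (c C i) ≢ a)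

IsApexForest : Graph → Set
IsApexForest G = Σ (Maybe (V G)) λ a → AcyclicAfterDeleting G a

data WalkIn (G : Graph) (B : VSet G) : V G → V G → Set where
  here : ∀ {u} → u ∈ˢ B → WalkIn G B u u
  step : ∀ {u w v} → u ∈ˢ B → Edge G u w → WalkIn G B w v → WalkIn G B u v

NonEmptyConnected : (G : Graph) → VSet G → Set
NonEmptyConnected G B =
  (∃ λ v → v ∈ˢ B) × (∀ u v → u ∈ˢ B → v ∈ˢ B → WalkIn G B u v)

record Model (H G : Graph) : Set where
  field
    B         : V H → VSet G
    disjoint  : ∀ x y g → g ∈ˢ B x → g ∈ˢ B y → x ≡ y
    connected : ∀ x → NonEmptyConnected G (B x)
    edges     : ∀ x y → Edge H x y →
                ∃ λ g → ∃ λ h → g ∈ˢ B x × h ∈ˢ B y × Edge G g h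

MinorFree : (H G : Graph) → Set
MinorFree H G = ¬ Model H G

record PathDecomposition (G : Graph) : Set where
  field
    m         : ℕ
    m≥1       : 1 ≤ m
    W         : Fin m → VSet G
    edgeCov   : ∀ u v → Edge G u v → ∃ λ i → u ∈ˢ W i × v ∈ˢ W i
    nonempty  : ∀ v → ∃ λ i → v ∈ˢ W i
    interval  : ∀ v (i j k : Fin m) → toℕ i ≤ toℕ j → toℕ j ≤ toℕ k →
                v ∈ˢ W i → v ∈ˢ W k → v ∈ˢ W j
open PathDecomposition public

record Layering (G : Graph) : Set where
  field
    L        : ℕ → VSet G
    layersDisjoint : ∀ i j v → v ∈ˢ L i → v ∈ˢ L j → i ≡ j
    cover    : ∀ v → ∃ λ i → v ∈ˢ L i
    layerEdges : ∀ u v → Edge G u v →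
               ∃ λ i → (L i u ∨ L (suc i) u) ≡ true × (L i v ∨ L (suc i) v) ≡ true
open Layering public

-- lpw(G) ≤ k: the minimum defining lpw is at most k, i.e. some path
-- decomposition and layering achieve max |W_i ∩ L_j| ≤ k.
LayeredPathwidth≤ : Graph → ℕ → Set
LayeredPathwidth≤ G k =
  Σ (PathDecomposition G) λ P → Σ (Layering G) λ Λ →
    ∀ (i : Fin (m P)) (j : ℕ) → ∣_∣ˢ {G} (λ v → W P i v ∧ L Λ j v) ≤ k

{-# OPTIONS --safe #-}
-- Let a be the apex of X, F = X − a and k = |F|. The core is a rooted version of Diestel's short proof of the
-- path-width theorem. Sweep G by growing a set A whose swept part has a path decomposition with bags of size at
-- most 2k − 1, the last bag containing the boundary of A. As long as the sweep is not complete, a model of F is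
-- grown one leaf at a time, each branch set keeping a vertex in the boundary of A: among the sets reachable from A
-- take a maximal one with boundary no larger than the current one, drag the branch sets along by Menger's theorem
-- (a small cut would, by submodularity of the boundary, itself be reachable), and add one outside vertex.
-- Once all of F is modelled the boundary has k vertices, and they are linked to k vertices of S outside A: a cut
-- with at most k − 1 vertices could be added to the last bag, yielding a reachable set of smaller boundary.
-- So without an S-rooted model of F, there is a path decomposition with bags of at most 2k − 1 vertices, covering S,
-- such that every remaining component attaches to a single bag.
-- If moreover S is the neighbourhood of a connected set U, an S-rooted model of F together with U is a model of X.
-- The bags then form one layer, and one recurses into the remaining components, with the part already layered
-- (cut down to what is connected to U) in the role of U.
module Submission where

open import Defs
open import Data.Bool using (Bool; true; false; _∧_; _∨_; if_then_else_)
import Data.Bool as Bool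
open import Data.Bool.Properties using (¬-not; ∧-comm; ∧-conicalˡ; ∧-conicalʳ; ∨-zeroʳ)
open import Data.Empty using (⊥)
open import Data.Fin using (Fin; zero; suc)
import Data.Fin as Fin
open import Data.Fin.Properties using (any?; all?; pigeonhole; toℕ<n; toℕ-fromℕ; toℕ-fromℕ<; toℕ-injective; toℕ-inject₁)
import Data.Fin.Properties as Fin
open import Data.Fin.Subset.Properties using (anySubset?)
open import Data.Maybe using (Maybe; just; nothing; _>>=_)
open import Data.Maybe.Properties using (just-injective)
import Data.Maybe.Properties as Maybe
open import Data.Nat using (ℕ; zero; suc; _+_; _*_; _∸_; _⊔_; _≤_; _<_; z≤n; s≤s; s≤s⁻¹)
open import Data.Nat.DivMod using (_/_; _%_; m≡m%n+[m/n]*n; m<n*o⇒m/o<n; m*n/n≡m; /-monoˡ-≤)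
open import Data.Nat.Properties
open import Data.Product using (Σ; ∃; _×_; _,_; proj₁; proj₂)
open import Data.Sum using (_⊎_; inj₁; inj₂; [_,_]′)
open import Data.Vec using (lookup; tabulate)
open import Data.Vec.Properties using (lookup∘tabulate)
open import Relation.Binary.Definitions using (tri<; tri≈; tri>)
open import Relation.Binary.PropositionalEquality
  using (_≡_; _≢_; refl; trans; cong; cong₂; subst; subst₂) renaming (sym to ≡-sym)
open import Relation.Nullary using (¬_; Dec; yes; no; does; contradiction)
open import Relation.Nullary.Decidable using (map′; ¬?; _×-dec_; _⊎-dec_; _→-dec_; dec-true)
open import Relation.Unary using (Decidable)

-- Finite sets as Boolean predicates.

BSet : ℕ → Set
BSet d = Fin d → Bool

private variable
  d : ℕ
  P Q : BSet d

_∉ˢ_ : Fin d → BSet d → Set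
v ∉ˢ A = ¬ (v ∈ˢ A)

_∈?_ : (v : Fin d) (A : BSet d) → Dec (v ∈ˢ A)
v ∈? A = A v Bool.≟ true

_⊆_ : BSet d → BSet d → Set
A ⊆ B = ∀ v → v ∈ˢ A → v ∈ˢ B

_⊆?_ : (A B : BSet d) → Dec (A ⊆ B)
A ⊆? B = all? (λ v → (v ∈? A) →-dec (v ∈? B))

abstract
  ⟦_⟧ : {A : Fin d → Set} → Decidable A → BSet d
  ⟦ A? ⟧ v = does (A? v)

  ∈⁺ : {A : Fin d → Set} {A? : Decidable A} {v : Fin d} → A v → v ∈ˢ ⟦ A? ⟧
  ∈⁺ {A? = A?} {v} a = dec-true (A? v) a

  ∈⁻ : {A : Fin d → Set} {A? : Decidable A} {v : Fin d} → v ∈ˢ ⟦ A? ⟧ → A v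
  ∈⁻ {A? = A?} {v} e with A? v
  ... | yes a = a

⊤ˢ ∅ˢ : BSet d
⊤ˢ _ = true
∅ˢ _ = false

-- The decision procedures are sealed because, unfolded, those of nested set expressions grow exponentially.
abstract
  ∪? : (A B : BSet d) → Decidable (λ v → v ∈ˢ A ⊎ v ∈ˢ B)
  ∪? A B v = (v ∈? A) ⊎-dec (v ∈? B)

  ∩? : (A B : BSet d) → Decidable (λ v → v ∈ˢ A × v ∈ˢ B)
  ∩? A B v = (v ∈? A) ×-dec (v ∈? B)

  ∖? : (A B : BSet d) → Decidable (λ v → v ∈ˢ A × v ∉ˢ B)
  ∖? A B v = (v ∈? A) ×-dec ¬? (v ∈? B)

_∪_ _∩_ _∖_ : BSet d → BSet d → BSet d
A ∪ B = ⟦ ∪? A B ⟧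
A ∩ B = ⟦ ∩? A B ⟧
A ∖ B = ⟦ ∖? A B ⟧

⁅_⁆ : Fin d → BSet d
⁅ x ⁆ = ⟦ (λ v → v Fin.≟ x) ⟧

⊈⇒∃ : ¬ (P ⊆ Q) → ∃ λ v → v ∈ˢ P × v ∉ˢ Q
⊈⇒∃ {P = P} {Q} P⊈Q with any? (λ v → (v ∈? P) ×-dec ¬? (v ∈? Q))
... | yes w = w
... | no ¬w = contradiction sub P⊈Q
  where
  sub : P ⊆ Q
  sub v p with v ∈? Q
  ... | yes q = q
  ... | no ¬q = contradiction (v , p , ¬q) ¬w

-- Cardinalities.

bit : Bool → ℕ
bit true  = 1
bit false = 0

count-suc : ∀ k (A : BSet (suc k)) → count (suc k) A ≡ bit (A zero) + count k (λ i → A (suc i))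
count-suc k A with A zero
... | true  = refl
... | false = refl

count-≤+ : ∀ k {P Q R T : BSet k} →
           (∀ v → bit (P v) + bit (Q v) ≤ bit (R v) + bit (T v)) →
           count k P + count k Q ≤ count k R + count k T
count-≤+ zero h = z≤n
count-≤+ (suc k) {P} {Q} {R} {T} h
  rewrite count-suc k P | count-suc k Q | count-suc k R | count-suc k T =
  subst₂ _≤_ (interchange (bit (P zero)) (bit (Q zero)) _ _)
             (interchange (bit (R zero)) (bit (T zero)) _ _)
             (+-mono-≤ (h zero) (count-≤+ k (λ v → h (suc v))))
  where
  open import Algebra.Properties.CommutativeSemigroup +-commutativeSemigroup using (interchange)

-- Every element is counted on the right at least as often as on the left. Submodularity of
-- boundaries is used in this form; empty sets as arguments give the bounds for unions and disjoint
-- sums.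
count-uncross : ∀ {k} {P Q R T : BSet k} →
  (∀ v → v ∈ˢ P → v ∈ˢ Q → v ∈ˢ R × v ∈ˢ T) →
  (∀ v → v ∈ˢ P → v ∈ˢ R ⊎ v ∈ˢ T) →
  (∀ v → v ∈ˢ Q → v ∈ˢ R ⊎ v ∈ˢ T) →
  count k P + count k Q ≤ count k R + count k T
count-uncross {k} {P} {Q} {R} {T} both left right = count-≤+ k pointwise
  where
  one : ∀ v → v ∈ˢ R ⊎ v ∈ˢ T → 1 ≤ bit (R v) + bit (T v)
  one v (inj₁ r) rewrite r = s≤s z≤n
  one v (inj₂ t) rewrite t = m≤n+m 1 (bit (R v))
  pointwise : ∀ v → bit (P v) + bit (Q v) ≤ bit (R v) + bit (T v)
  pointwise v with P v in p | Q v in q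
  ... | false | false = z≤n
  ... | true  | false = one v (left v p)
  ... | false | true  = one v (right v q)
  ... | true  | true  with both v p q
  ...   | r , t rewrite r | t = ≤-refl

count-∅ : ∀ k → count k ∅ˢ ≡ 0
count-∅ zero    = refl
count-∅ (suc k) = count-∅ k

count-⊤ : ∀ k → count k ⊤ˢ ≡ k
count-⊤ zero    = refl
count-⊤ (suc k) = cong suc (count-⊤ k)

module _ {k : ℕ} where

  count-∪ : {P Q R : BSet k} → (∀ v → v ∈ˢ P → v ∈ˢ Q ⊎ v ∈ˢ R) → count k P ≤ count k Q + count k R
  count-∪ {P} {Q} {R} h = subst (_≤ count k Q + count k R)
    (trans (cong (count k P +_) (count-∅ k)) (+-identityʳ (count k P)))
    (count-uncross {P = P} {∅ˢ} {Q} {R} (λ _ _ ()) h (λ _ ()))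

  count-mono : {P Q : BSet k} → P ⊆ Q → count k P ≤ count k Q
  count-mono {P} {Q} h = subst (count k P ≤_) (trans (cong (count k Q +_) (count-∅ k)) (+-identityʳ _))
    (count-∪ {P} {Q} {∅ˢ} (λ v p → inj₁ (h v p)))

  count-⊎ : {P Q R : BSet k} → (∀ v → v ∈ˢ P → v ∉ˢ Q) → P ⊆ R → Q ⊆ R → count k P + count k Q ≤ count k R
  count-⊎ {P} {Q} {R} d h h′ = subst (_ ≤_) (trans (cong (count k R +_) (count-∅ k)) (+-identityʳ _))
    (count-uncross {T = ∅ˢ} (λ v p q → contradiction q (d v p)) (λ v p → inj₁ (h v p)) (λ v q → inj₁ (h′ v q)))

  count≤k : (P : BSet k) → count k P ≤ k
  count≤k P = subst (count k P ≤_) (count-⊤ k) (count-mono {P} {⊤ˢ} (λ _ _ → refl))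

  count-empty : {P : BSet k} → (∀ v → v ∉ˢ P) → count k P ≡ 0
  count-empty {P} h = n≤0⇒n≡0 (subst (count k P ≤_) (count-∅ k)
    (count-mono {P = P} {∅ˢ} (λ v p → contradiction p (h v))))

count-⁅⁆ : ∀ {k} (x : Fin k) → count k ⁅ x ⁆ ≡ 1
count-⁅⁆ {suc k} zero = trans (count-suc k ⁅ zero ⁆)
  (subst₂ (λ b c → bit b + c ≡ 1) (≡-sym first) (≡-sym rest) refl)
  where
  first : zero ∈ˢ ⁅ zero {k} ⁆
  first = ∈⁺ refl
  rest : count k (λ i → ⁅ zero ⁆ (suc i)) ≡ 0
  rest = count-empty {k = k} {P = λ i → ⁅ zero ⁆ (suc i)} (λ v e → Fin.0≢1+n (≡-sym (∈⁻ {v = suc v} e)))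
count-⁅⁆ {suc k} (suc y) = trans (count-suc k ⁅ suc y ⁆)
  (subst₂ (λ b c → bit b + c ≡ 1) (≡-sym first) (≡-sym rest) refl)
  where
  first : ⁅ suc y ⁆ zero ≡ false
  first = ¬-not (λ e → Fin.0≢1+n (∈⁻ {v = zero} e))
  rest : count k (λ i → ⁅ suc y ⁆ (suc i)) ≡ 1
  rest = trans (≤-antisym (count-mono {k = k} {Q = ⁅ y ⁆} (λ v e → ∈⁺ (Fin.suc-injective (∈⁻ {v = suc v} e))))
                          (count-mono {k = k} {P = ⁅ y ⁆} (λ v e → ∈⁺ {v = suc v} (cong suc (∈⁻ {v = v} e)))))
               (count-⁅⁆ y)

module _ {k : ℕ} where

  count-≤suc : {P Q : BSet k} (x : Fin k) → (∀ v → v ∈ˢ P → v ∈ˢ Q ⊎ v ≡ x) → count k P ≤ suc (count k Q)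
  count-≤suc {P} {Q} x h = subst (count k P ≤_) (trans (cong (count k Q +_) (count-⁅⁆ x)) (+-comm _ 1))
    (count-∪ {P = P} {Q} {⁅ x ⁆} (λ v p → [ inj₁ , (λ e → inj₂ (∈⁺ e)) ]′ (h v p)))

  count-< : {P Q : BSet k} → P ⊆ Q → (x : Fin k) → x ∈ˢ Q → x ∉ˢ P → count k P < count k Q
  count-< {P} {Q} h x q ¬p = subst (λ z → z + count k P ≤ count k Q) (count-⁅⁆ x)
    (count-⊎ {P = ⁅ x ⁆} {P} {Q} (λ v e p → ¬p (subst (_∈ˢ P) (∈⁻ e) p)) (λ v e → subst (_∈ˢ Q) (≡-sym (∈⁻ e)) q) h)

  ∈⇒count≰0 : {P : BSet k} (x : Fin k) → x ∈ˢ P → ¬ (count k P ≤ 0)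
  ∈⇒count≰0 {P} x p le = contradiction (<-≤-trans (count-< {∅ˢ} {P} (λ _ ()) x p λ ()) le) λ ()

  count-∖⁅⁆ : {P : BSet k} (x : Fin k) → x ∈ˢ P → count k (P ∖ ⁅ x ⁆) < count k P
  count-∖⁅⁆ x p = count-< (λ v e → proj₁ (∈⁻ e)) x p (λ e → proj₂ (∈⁻ {v = x} e) (∈⁺ refl))

  count-≥⇒⊇ : {P Q : BSet k} → P ⊆ Q → count k Q ≤ count k P → Q ⊆ P
  count-≥⇒⊇ {P} h c v q with v ∈? P
  ... | yes p = p
  ... | no ¬p = contradiction c (<⇒≱ (count-< h v q ¬p))

  count-<⇒∃ : {P Q : BSet k} → count k P < count k Q → ∃ λ v → v ∈ˢ Q × v ∉ˢ P
  count-<⇒∃ {P} {Q} lt = ⊈⇒∃ (λ h → <⇒≱ lt (count-mono h))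

-- Exhaustive search over subsets.

module _ {k : ℕ} where

  -- Subsets are compared by mutual inclusion: the search runs over vectors of Booleans, which
  -- recover a predicate only up to pointwise equality.
  Extensional : (BSet k → Set) → Set
  Extensional Φ = ∀ {A B} → A ⊆ B → B ⊆ A → Φ A → Φ B

  anySet? : {Φ : BSet k → Set} → Extensional Φ → Decidable Φ → Dec (∃ Φ)
  anySet? ext Φ? = map′ (λ (s , p) → lookup s , p)
    (λ (A , p) → tabulate A ,
      ext (λ v a → trans (lookup∘tabulate A v) a) (λ v a → trans (≡-sym (lookup∘tabulate A v)) a) p)
    (anySubset? (λ s → Φ? (lookup s)))

  argmin : {Φ : BSet k → Set} (f : BSet k → ℕ) → (∀ {A B} → A ⊆ B → B ⊆ A → f B ≤ f A) →
           Extensional Φ → Decidable Φ → ∃ Φ →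
           ∃ λ Z → Φ Z × (∀ Z′ → Φ Z′ → f Z ≤ f Z′)
  argmin {Φ} f f-ext ext Φ? (A , a) = go (f A) A a ≤-refl
    where
    go : ∀ m Z → Φ Z → f Z ≤ m → ∃ λ Z → Φ Z × (∀ Z′ → Φ Z′ → f Z ≤ f Z′)
    go m Z z le with anySet? {Φ = λ Z′ → Φ Z′ × f Z′ < f Z}
        (λ ab ba (p , q) → ext ab ba p , ≤-<-trans (f-ext ab ba) q)
        (λ Z′ → Φ? Z′ ×-dec (f Z′ <? f Z))
    go m Z z le | no ¬s = Z , z , λ Z′ z′ → ≮⇒≥ (λ lt → ¬s (Z′ , z′ , lt))
    go zero Z z le | yes (Z′ , z′ , lt) = contradiction (<-≤-trans lt le) λ ()
    go (suc m) Z z le | yes (Z′ , z′ , lt) = go m Z′ z′ (s≤s⁻¹ (<-≤-trans lt le))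

-- Walks.

module _ {G : Graph} where

  edge-sym : ∀ {u v} → Edge G u v → Edge G v u
  edge-sym {u} {v} e = trans (Graph.sym G v u) e

  edge? : ∀ u v → Dec (Edge G u v)
  edge? u v = adj G u v Bool.≟ true

  walk-start : ∀ {B u v} → WalkIn G B u v → u ∈ˢ B
  walk-start (here p)     = p
  walk-start (step p _ _) = p

  walk-mono : ∀ {B B′ u v} → B ⊆ B′ → WalkIn G B u v → WalkIn G B′ u v
  walk-mono h (here p)     = here (h _ p)
  walk-mono h (step p e w) = step (h _ p) e (walk-mono h w)

  walk-trans : ∀ {B u v w} → WalkIn G B u v → WalkIn G B v w → WalkIn G B u w
  walk-trans (here _)     w′ = w′
  walk-trans (step p e w) w′ = step p e (walk-trans w w′)

  walk-sym : ∀ {B u v} → WalkIn G B u v → WalkIn G B v u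
  walk-sym (here p)     = here p
  walk-sym (step p e w) = walk-trans (walk-sym w) (step (walk-start w) (edge-sym e) (here p))

-- Linkages as partial colourings.

-- A family of sets is stored as the fibres of a partial function, which makes it disjoint by
-- construction.
Coloring : Graph → ℕ → Set
Coloring G k = V G → Maybe (Fin k)

abstract
  fib? : ∀ {k} {G : Graph} (κ : Coloring G k) (x : Fin k) → Decidable (λ v → κ v ≡ just x)
  fib? κ x v = Maybe.≡-dec Fin._≟_ (κ v) (just x)

fib : ∀ {k} {G : Graph} → Coloring G k → Fin k → VSet G
fib {G = G} κ x = ⟦ fib? {G = G} κ x ⟧

-- Disjoint connected sets, one around each p ∈ P, each meeting Q; the set of p is the fibre of κ over p.
record Linkage (G : Graph) (P Q H : VSet G) : Set where
  field
    κ      : Coloring G (n G)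
    source : ∀ p → p ∈ˢ P → κ p ≡ just p
    sound  : ∀ v p → κ v ≡ just p → p ∈ˢ P × v ∈ˢ H
    walk   : ∀ v p → κ v ≡ just p → WalkIn G (fib {G = G} κ p) v p
    sink   : ∀ p → p ∈ˢ P → ∃ λ q → q ∈ˢ Q × κ q ≡ just p

-- The colours of `f` travel along the linkage: a vertex outside `A` takes the colour of the source
-- of its linkage set. This both concatenates linkages and prolongs branch sets.
module Glue {G : Graph} {k : ℕ} {P Q H : VSet G} (A : VSet G) (f : Coloring G k)
            (f⊆A : ∀ v x → f v ≡ just x → v ∈ˢ A)
            (Λ : Linkage G P Q H) (A∩H⊆P : ∀ v → v ∈ˢ A → v ∈ˢ H → v ∈ˢ P) where
  open Linkage Λ

  glue : Coloring G k
  glue v = if A v then f v else (κ v >>= f)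

  glue-in : ∀ v {x} → f v ≡ just x → glue v ≡ just x
  glue-in v {x} e rewrite f⊆A v x e = e

  glue-link : ∀ v p {x} → κ v ≡ just p → f p ≡ just x → glue v ≡ just x
  glue-link v p {x} e e′ with A v in a
  ... | false rewrite e = e′
  ... | true = trans (cong f v≡p) e′
    where
    -- A linkage vertex inside `A` lies in `P`, hence is the source of its own set.
    v≡p : v ≡ p
    v≡p = just-injective (trans (≡-sym (source v (A∩H⊆P v a (proj₂ (sound v p e))))) e)

  glue-inv : ∀ v {x} → glue v ≡ just x →
             f v ≡ just x ⊎ (v ∉ˢ A × ∃ λ p → κ v ≡ just p × f p ≡ just x)
  glue-inv v e with A v in a
  ... | true  = inj₁ e
  ... | false with κ v in e′
  ...   | just p = inj₂ ((λ ()) , p , refl , e)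

  glue-walk-in : ∀ {u v x} → WalkIn G (fib {G = G} f x) u v → WalkIn G (fib {G = G} glue x) u v
  glue-walk-in = walk-mono (λ v e → ∈⁺ (glue-in v (∈⁻ e)))

  glue-walk-out : ∀ v p {x} → κ v ≡ just p → f p ≡ just x → WalkIn G (fib {G = G} glue x) v p
  glue-walk-out v p e e′ = walk-mono (λ u e″ → ∈⁺ (glue-link u p (∈⁻ e″) e′)) (walk v p e)

-- Menger's theorem.

module Menger (G : Graph) where

  -- If P ⊆ Z ⊆ H, every path of G[H] from P to Q meets bd H Q Z.
  abstract
    bd? : ∀ H Q Z → Decidable (λ v → v ∈ˢ Z × (v ∈ˢ Q ⊎ ∃ λ u → Edge G v u × u ∈ˢ H × u ∉ˢ Z))
    bd? H Q Z v = (v ∈? Z) ×-dec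
      ((v ∈? Q) ⊎-dec any? (λ u → edge? {G} v u ×-dec (u ∈? H) ×-dec ¬? (u ∈? Z)))

  bd : (H Q Z : VSet G) → VSet G
  bd H Q Z = ⟦ bd? H Q Z ⟧

  bd-ext : ∀ {H Q A B} → A ⊆ B → B ⊆ A → bd H Q A ⊆ bd H Q B
  bd-ext ab ba v e with ∈⁻ e
  ... | a , inj₁ q = ∈⁺ (ab v a , inj₁ q)
  ... | a , inj₂ (u , e′ , h , ¬a) = ∈⁺ (ab v a , inj₂ (u , e′ , h , λ b → ¬a (ba u b)))

  -- Every separator of `P` from `Q` in G[H] contains `bd H Q Z` for some such `Z`, so this says
  -- that no separator is smaller than `P`.
  Unseparated : (P Q H : VSet G) → Set
  Unseparated P Q H = ∀ Z → P ⊆ Z → Z ⊆ H → count (n G) P ≤ count (n G) (bd H Q Z)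

  -- That `Z` lies properly between `P` and `H` makes both halves of the split smaller than `H`.
  Tight : (P Q H Z : VSet G) → Set
  Tight P Q H Z = P ⊆ Z × Z ⊆ H × count (n G) (bd H Q Z) ≤ count (n G) P ×
                  (∃ λ z → z ∈ˢ Z × z ∉ˢ P) × (∃ λ h → h ∈ˢ H × h ∉ˢ Z)

  tight? : ∀ P Q H → Dec (∃ (Tight P Q H))
  tight? P Q H = anySet?
    (λ ab ba (pz , zh , le , (z , z∈ , z∉) , (h , h∈ , h∉)) →
      (λ v p → ab v (pz v p)) , (λ v z → zh v (ba v z)) ,
      ≤-trans (count-mono (bd-ext ba ab)) le ,
      (z , ab z z∈ , z∉) , (h , h∈ , λ b → h∉ (ba h b)))
    (λ Z → (P ⊆? Z) ×-dec (Z ⊆? H) ×-dec (count (n G) (bd H Q Z) ≤? count (n G) P) ×-dec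
           any? (λ z → (z ∈? Z) ×-dec ¬? (z ∈? P)) ×-dec any? (λ h → (h ∈? H) ×-dec ¬? (h ∈? Z)))

  module Split {P Q H Z : VSet G} (Z⊆H : Z ⊆ H)
               (Λ₁ : Linkage G P (bd H Q Z) Z)
               (Λ₂ : Linkage G (bd H Q Z) Q ((H ∖ Z) ∪ bd H Q Z)) where
    private
      module Λ₁ = Linkage Λ₁
      module Λ₂ = Linkage Λ₂
      Z∩H⊆T : ∀ v → v ∈ˢ Z → v ∈ˢ ((H ∖ Z) ∪ bd H Q Z) → v ∈ˢ bd H Q Z
      Z∩H⊆T v z h with ∈⁻ h
      ... | inj₁ h∖z = contradiction z (proj₂ (∈⁻ h∖z))
      ... | inj₂ t   = t
    open Glue Z Λ₁.κ (λ v x e → proj₂ (Λ₁.sound v x e)) Λ₂ Z∩H⊆T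

    split : Linkage G P Q H
    split = record
      { κ      = glue
      ; source = λ p p∈ → glue-in p (Λ₁.source p p∈)
      ; sound  = λ v p e → sound v p (glue-inv v e)
      ; walk   = λ v p e → walk v p (glue-inv v e)
      ; sink   = sink
      }
      where
      sound : ∀ v p → _ → p ∈ˢ P × v ∈ˢ H
      sound v p (inj₁ e) = proj₁ (Λ₁.sound v p e) , Z⊆H v (proj₂ (Λ₁.sound v p e))
      sound v p (inj₂ (v∉Z , z , e , e′)) with ∈⁻ (proj₂ (Λ₂.sound v z e))
      ... | inj₁ h = proj₁ (Λ₁.sound z p e′) , proj₁ (∈⁻ h)
      ... | inj₂ t = contradiction (proj₁ (∈⁻ t)) v∉Z
      walk : ∀ v p → _ → WalkIn G (fib {G = G} glue p) v p
      walk v p (inj₁ e) = glue-walk-in (Λ₁.walk v p e)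
      walk v p (inj₂ (_ , z , e , e′)) =
        walk-trans (glue-walk-out v z e e′) (glue-walk-in (Λ₁.walk z p e′))
      sink : ∀ p → p ∈ˢ P → ∃ λ q → q ∈ˢ Q × glue q ≡ just p
      sink p p∈ with Λ₁.sink p p∈
      ... | z , z∈T , e with Λ₂.sink z z∈T
      ...   | q , q∈Q , e′ = q , q∈Q , glue-link q z e′ e

  module Shift {P P′ Q H : VSet G} {p : V G}
               (Λ : Linkage G P′ Q (H ∖ ⁅ p ⁆)) where
    private module Λ = Linkage Λ

    p-free : ∀ x → Λ.κ p ≢ just x
    p-free x e = proj₂ (∈⁻ {v = p} (proj₂ (Λ.sound p x e))) (∈⁺ refl)

    keep : p ∈ˢ P → p ∈ˢ H → p ∈ˢ Q → (∀ x → x ∈ˢ P′ → x ∈ˢ P × x ≢ p) → (∀ x → x ∈ˢ P → x ≢ p → x ∈ˢ P′) →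
           Linkage G P Q H
    keep p∈P p∈H p∈Q P′⊆ P⊆ = record
      { κ = κ ; source = source ; sound = sound ; walk = walk ; sink = sink }
      where
      κ : Coloring G (n G)
      κ v with v Fin.≟ p
      ... | yes _ = just p
      ... | no  _ = Λ.κ v
      κ-p : κ p ≡ just p
      κ-p with p Fin.≟ p
      ... | yes _ = refl
      ... | no ¬e = contradiction refl ¬e
      κ-other : ∀ v x → Λ.κ v ≡ just x → κ v ≡ just x
      κ-other v x e with v Fin.≟ p
      ... | yes refl = contradiction e (p-free x)
      ... | no _ = e
      κ-inv : ∀ v x → κ v ≡ just x → (v ≡ p × x ≡ p) ⊎ Λ.κ v ≡ just x
      κ-inv v x e with v Fin.≟ p
      ... | yes v≡p = inj₁ (v≡p , ≡-sym (just-injective e))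
      ... | no _    = inj₂ e
      source : ∀ x → x ∈ˢ P → κ x ≡ just x
      source x x∈ with x Fin.≟ p
      ... | yes refl = refl
      ... | no x≢p   = Λ.source x (P⊆ x x∈ x≢p)
      sound : ∀ v x → κ v ≡ just x → x ∈ˢ P × v ∈ˢ H
      sound v x e with κ-inv v x e
      ... | inj₁ (refl , refl) = p∈P , p∈H
      ... | inj₂ e′ = proj₁ (P′⊆ x (proj₁ (Λ.sound v x e′))) , proj₁ (∈⁻ (proj₂ (Λ.sound v x e′)))
      walk : ∀ v x → κ v ≡ just x → WalkIn G (fib {G = G} κ x) v x
      walk v x e with κ-inv v x e
      ... | inj₁ (refl , refl) = here (∈⁺ κ-p)
      ... | inj₂ e′ = walk-mono (λ u e″ → ∈⁺ (κ-other u x (∈⁻ e″))) (Λ.walk v x e′)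
      sink : ∀ x → x ∈ˢ P → ∃ λ q → q ∈ˢ Q × κ q ≡ just x
      sink x x∈ with x Fin.≟ p
      ... | yes refl = p , p∈Q , κ-p
      ... | no x≢p with Λ.sink x (P⊆ x x∈ x≢p)
      ...   | q , q∈Q , e = q , q∈Q , κ-other q x e

    -- the set grown from the neighbour q of p is handed over to p
    move : ∀ q → Edge G p q → q ∈ˢ P′ → q ∉ˢ P → p ∈ˢ P → p ∈ˢ H →
           (∀ x → x ∈ˢ P′ → x ≢ q → x ∈ˢ P × x ≢ p) → (∀ x → x ∈ˢ P → x ≢ p → x ∈ˢ P′) →
           Linkage G P Q H
    move q pq q∈P′ q∉P p∈P p∈H P′⊆ P⊆ = record
      { κ = κ ; source = source ; sound = sound ; walk = walk ; sink = sink }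
      where
      rename : V G → V G
      rename x with x Fin.≟ q
      ... | yes _ = p
      ... | no  _ = x
      κ : Coloring G (n G)
      κ v with v Fin.≟ p
      ... | yes _ = just p
      ... | no  _ = Λ.κ v >>= (λ x → just (rename x))
      rename-q : rename q ≡ p
      rename-q with q Fin.≟ q
      ... | yes _ = refl
      ... | no ¬e = contradiction refl ¬e
      rename-other : ∀ x → x ≢ q → rename x ≡ x
      rename-other x x≢q with x Fin.≟ q
      ... | yes e = contradiction e x≢q
      ... | no  _ = refl
      κ-p : κ p ≡ just p
      κ-p with p Fin.≟ p
      ... | yes _ = refl
      ... | no ¬e = contradiction refl ¬e
      κ-other : ∀ v x → Λ.κ v ≡ just x → κ v ≡ just (rename x)
      κ-other v x e with v Fin.≟ p
      ... | yes refl = contradiction e (p-free x)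
      ... | no _ rewrite e = refl
      κ-inv : ∀ v x → κ v ≡ just x →
              (v ≡ p × x ≡ p) ⊎ (Λ.κ v ≡ just q × x ≡ p) ⊎ (Λ.κ v ≡ just x × x ≢ q)
      κ-inv v x e with v Fin.≟ p
      ... | yes v≡p = inj₁ (v≡p , ≡-sym (just-injective e))
      ... | no _ with Λ.κ v in e′
      ...   | just y with y Fin.≟ q
      ...     | yes refl = inj₂ (inj₁ (refl , ≡-sym (just-injective e)))
      ...     | no y≢q with refl ← just-injective e = inj₂ (inj₂ (refl , y≢q))
      source : ∀ x → x ∈ˢ P → κ x ≡ just x
      source x x∈ with x Fin.≟ p
      ... | yes refl = refl
      ... | no x≢p rewrite Λ.source x (P⊆ x x∈ x≢p) =
        cong just (rename-other x (λ { refl → q∉P x∈ }))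
      sound : ∀ v x → κ v ≡ just x → x ∈ˢ P × v ∈ˢ H
      sound v x e with κ-inv v x e
      ... | inj₁ (refl , refl) = p∈P , p∈H
      ... | inj₂ (inj₁ (e′ , refl)) = p∈P , proj₁ (∈⁻ (proj₂ (Λ.sound v q e′)))
      ... | inj₂ (inj₂ (e′ , x≢q)) =
        proj₁ (P′⊆ x (proj₁ (Λ.sound v x e′)) x≢q) , proj₁ (∈⁻ (proj₂ (Λ.sound v x e′)))
      fib⊆ : ∀ {x y} → rename x ≡ y → ∀ {u v} → WalkIn G (fib {G = G} Λ.κ x) u v → WalkIn G (fib {G = G} κ y) u v
      fib⊆ {x} e = walk-mono (λ u e″ → ∈⁺ (trans (κ-other u x (∈⁻ e″)) (cong just e)))
      walk : ∀ v x → κ v ≡ just x → WalkIn G (fib {G = G} κ x) v x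
      walk v x e with κ-inv v x e
      ... | inj₁ (refl , refl) = here (∈⁺ κ-p)
      ... | inj₂ (inj₁ (e′ , refl)) = walk-trans (fib⊆ rename-q (Λ.walk v q e′))
        (step (∈⁺ (trans (κ-other q q (Λ.source q q∈P′)) (cong just rename-q))) (edge-sym {G} pq) (here (∈⁺ κ-p)))
      ... | inj₂ (inj₂ (e′ , x≢q)) = fib⊆ (rename-other x x≢q) (Λ.walk v x e′)
      sink : ∀ x → x ∈ˢ P → ∃ λ q → q ∈ˢ Q × κ q ≡ just x
      sink x x∈ with x Fin.≟ p
      ... | yes refl with Λ.sink q q∈P′
      ...   | z , z∈Q , e = z , z∈Q , trans (κ-other z q e) (cong just rename-q)
      sink x x∈ | no x≢p with Λ.sink x (P⊆ x x∈ x≢p)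
      ...   | z , z∈Q , e = z , z∈Q , trans (κ-other z x e) (cong just (rename-other x (λ { refl → q∉P x∈ })))

module MengerProof (G : Graph) where
  open Menger G

  private
    ∣_∣ : VSet G → ℕ
    ∣ A ∣ = count (n G) A

  -- An edge from `Y` that leaves `Z` as well starts in `bd H Q Z`, so the boundary of `Y` in `H`
  -- stays inside its boundary in `Z`.
  split-left : ∀ {P Q H Z} → Unseparated P Q H → Z ⊆ H → Unseparated P (bd H Q Z) Z
  split-left {P} {Q} {H} {Z} uns zh Y py yz =
    ≤-trans (uns Y py (λ v y → zh v (yz v y))) (count-mono sub)
    where
    sub : bd H Q Y ⊆ bd Z (bd H Q Z) Y
    sub v e with ∈⁻ e
    ... | y , inj₁ q = ∈⁺ (y , inj₁ (∈⁺ (yz v y , inj₁ q)))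
    ... | y , inj₂ (u , vu , h , ¬y) with u ∈? Z
    ...   | yes z = ∈⁺ (y , inj₂ (u , vu , z , ¬y))
    ...   | no ¬z = ∈⁺ (y , inj₁ (∈⁺ (yz v y , inj₂ (u , vu , h , ¬z))))

  -- The hypothesis is applied to `Z ∪ Y`. Its boundary lies in that of `Y`, because `Y` contains
  -- `bd H Q Z`, where every edge leaving `Z` starts.
  split-right : ∀ {P Q H Z} → Unseparated P Q H → Tight P Q H Z →
                Unseparated (bd H Q Z) Q ((H ∖ Z) ∪ bd H Q Z)
  split-right {P} {Q} {H} {Z} uns (pz , zh , le , _) Y ty yh =
    ≤-trans le (≤-trans (uns (Z ∪ Y) (λ v p → ∈⁺ (inj₁ (pz v p))) ZY⊆H) (count-mono sub))
    where
    ZY⊆H : (Z ∪ Y) ⊆ H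
    ZY⊆H v e with ∈⁻ e
    ... | inj₁ z = zh v z
    ... | inj₂ y with ∈⁻ (yh v y)
    ...   | inj₁ hz = proj₁ (∈⁻ hz)
    ...   | inj₂ t  = zh v (proj₁ (∈⁻ t))
    sub : bd H Q (Z ∪ Y) ⊆ bd ((H ∖ Z) ∪ bd H Q Z) Q Y
    sub v e with ∈⁻ e
    ... | zy , w with v ∈? Y
    ...   | yes y = ∈⁺ (y , out w)
      where
      out : _ → _
      out (inj₁ q) = inj₁ q
      out (inj₂ (u , vu , h , ¬zy)) =
        inj₂ (u , vu , ∈⁺ (inj₁ (∈⁺ (h , λ z → ¬zy (∈⁺ (inj₁ z))))) , λ y → ¬zy (∈⁺ (inj₂ y)))
    ...   | no ¬y with ∈⁻ zy
    ...     | inj₂ y = contradiction y ¬y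
    ...     | inj₁ z = contradiction (ty v (∈⁺ (z , out w))) ¬y
      where
      out : _ → _
      out (inj₁ q) = inj₁ q
      out (inj₂ (u , vu , h , ¬zy)) = inj₂ (u , vu , h , λ z → ¬zy (∈⁺ (inj₁ z)))

  insert-⊆ : ∀ {H : VSet G} p Y → p ∈ˢ H → Y ⊆ (H ∖ ⁅ p ⁆) → (Y ∪ ⁅ p ⁆) ⊆ H
  insert-⊆ {H} p Y p∈H yh v e =
    [ (λ y → proj₁ (∈⁻ (yh v y))) , (λ v≡p → subst (_∈ˢ H) (≡-sym (∈⁻ v≡p)) p∈H) ]′ (∈⁻ e)

  ⊆-insert : ∀ {P : VSet G} p Y → (P ∖ ⁅ p ⁆) ⊆ Y → P ⊆ (Y ∪ ⁅ p ⁆)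
  ⊆-insert p Y py v p∈ with v ∈? ⁅ p ⁆
  ... | yes e = ∈⁺ (inj₂ e)
  ... | no ¬e = ∈⁺ (inj₁ (py v (∈⁺ (p∈ , ¬e))))

  bd-insert : ∀ {H Q} p Y v → v ∈ˢ bd H Q (Y ∪ ⁅ p ⁆) → v ∈ˢ bd (H ∖ ⁅ p ⁆) Q Y ⊎ v ≡ p
  bd-insert p Y v e with ∈⁻ e
  ... | vy , w with ∈⁻ vy
  ...   | inj₂ v≡p = inj₂ (∈⁻ v≡p)
  ...   | inj₁ y with w
  ...     | inj₁ q = inj₁ (∈⁺ (y , inj₁ q))
  ...     | inj₂ (u , vu , h , ¬yp) = inj₁ (∈⁺ (y , inj₂ (u , vu ,
              ∈⁺ (h , λ e′ → ¬yp (∈⁺ (inj₂ e′))) , λ y′ → ¬yp (∈⁺ (inj₁ y′)))))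

  -- Induction on H: split at a tight Z if there is one; otherwise no bd H Q Z with P ⊊ Z ⊊ H is as small as P, and
  -- a source p ∉ Q may be replaced by any of its neighbours in H ∖ P while p is deleted from H.
  menger′ : ∀ k P Q H → ∣ H ∣ ≤ k → P ⊆ H → Unseparated P Q H → Linkage G P Q H
  shift : ∀ k P Q H → ∣ H ∣ ≤ k → P ⊆ H → Unseparated P Q H → ¬ ∃ (Tight P Q H) →
          ∃ (_∈ˢ P) → Linkage G P Q H

  menger′ k P Q H H≤k P⊆H uns with tight? P Q H
  menger′ k P Q H H≤k P⊆H uns | no ¬tight with any? (_∈? P)
  ... | yes P≠∅ = shift k P Q H H≤k P⊆H uns ¬tight P≠∅
  ... | no P=∅ = record
    { κ = λ _ → nothing ; source = λ p p∈ → contradiction (p , p∈) P=∅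
    ; sound = λ _ _ () ; walk = λ _ _ () ; sink = λ p p∈ → contradiction (p , p∈) P=∅ }
  menger′ zero P Q H H≤k P⊆H uns | yes (_ , _ , _ , _ , _ , h , h∈H , h∉Z) =
    contradiction H≤k (∈⇒count≰0 h h∈H)
  menger′ (suc k) P Q H H≤k P⊆H uns | yes (Z , tight@(pz , zh , le , (z , z∈Z , z∉P) , (h , h∈H , h∉Z))) =
    Split.split zh
      (menger′ k P (bd H Q Z) Z
        (s≤s⁻¹ (<-≤-trans (count-< zh h h∈H h∉Z) H≤k)) pz (split-left {P} {Q} {H} {Z} uns zh))
      (menger′ k (bd H Q Z) Q ((H ∖ Z) ∪ bd H Q Z)
        (s≤s⁻¹ (<-≤-trans right< H≤k)) (λ v t → ∈⁺ (inj₂ t)) (split-right uns tight))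
    where
    -- The cut has at most as many vertices as `P`, fewer than `Z`; so some vertex of `Z` is missing
    -- from the second half.
    inner : ∃ λ v → v ∈ˢ Z × v ∉ˢ bd H Q Z
    inner = count-<⇒∃ (≤-<-trans le (count-< pz z z∈Z z∉P))
    right< : ∣ (H ∖ Z) ∪ bd H Q Z ∣ < ∣ H ∣
    right< = count-< sub (proj₁ inner) (zh _ (proj₁ (proj₂ inner))) notin
      where
      sub : ((H ∖ Z) ∪ bd H Q Z) ⊆ H
      sub v e with ∈⁻ e
      ... | inj₁ hz = proj₁ (∈⁻ hz)
      ... | inj₂ t  = zh v (proj₁ (∈⁻ t))
      notin : proj₁ inner ∉ˢ ((H ∖ Z) ∪ bd H Q Z)
      notin e with ∈⁻ e
      ... | inj₁ hz = proj₂ (∈⁻ hz) (proj₁ (proj₂ inner))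
      ... | inj₂ t  = proj₂ (proj₂ inner) t

  shift zero P Q H H≤k P⊆H uns ¬tight (p , p∈P) =
    contradiction H≤k (∈⇒count≰0 p (P⊆H p p∈P))
  shift (suc k) P Q H H≤k P⊆H uns ¬tight (p , p∈P) with p ∈? Q
  ... | yes p∈Q = Shift.keep linkage p∈P (P⊆H p p∈P) p∈Q
      (λ x e → proj₁ (∈⁻ e) , λ x≡p → proj₂ (∈⁻ {v = x} e) (∈⁺ x≡p))
      (λ x x∈ x≢p → ∈⁺ (x∈ , λ e → x≢p (∈⁻ e)))
    where
    uns′ : Unseparated (P ∖ ⁅ p ⁆) Q (H ∖ ⁅ p ⁆)
    uns′ Y py yh = s≤s⁻¹ (≤-trans P< (≤-trans (uns (Y ∪ ⁅ p ⁆) P⊆ ⊆H) (count-≤suc p (bd-insert {H} {Q} p Y))))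
      where
      P⊆ : P ⊆ (Y ∪ ⁅ p ⁆)
      P⊆ = ⊆-insert {P} p Y py
      ⊆H : (Y ∪ ⁅ p ⁆) ⊆ H
      ⊆H = insert-⊆ {H} p Y (P⊆H p p∈P) yh
      P< : suc ∣ P ∖ ⁅ p ⁆ ∣ ≤ ∣ P ∣
      P< = count-∖⁅⁆ p p∈P
    linkage = menger′ k (P ∖ ⁅ p ⁆) Q (H ∖ ⁅ p ⁆)
      (s≤s⁻¹ (<-≤-trans (count-∖⁅⁆ p (P⊆H p p∈P)) H≤k))
      (λ v e → ∈⁺ (P⊆H v (proj₁ (∈⁻ e)) , proj₂ (∈⁻ {v = v} e))) uns′
  ... | no p∉Q with any? (λ q → edge? {G} p q ×-dec (q ∈? H) ×-dec ¬? (q ∈? P))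
  -- Without such a neighbour the boundary of `Z = P` would omit `p` and be too small.
  ...   | no isolated = contradiction (uns P (λ _ e → e) P⊆H) (<⇒≱ (count-< (λ v e → proj₁ (∈⁻ e)) p p∈P p∉bd))
    where
    p∉bd : p ∉ˢ bd H Q P
    p∉bd e with proj₂ (∈⁻ {v = p} e)
    ... | inj₁ q = p∉Q q
    ... | inj₂ w = isolated w
  ...   | yes (q , pq , q∈H , q∉P) =
      Shift.move linkage q pq (∈⁺ (inj₂ (∈⁺ refl))) q∉P p∈P (P⊆H p p∈P) back
        (λ x x∈ x≢p → ∈⁺ (inj₁ (∈⁺ (x∈ , λ e → x≢p (∈⁻ e)))))
    where
    P′ = (P ∖ ⁅ p ⁆) ∪ ⁅ q ⁆
    q≢p : q ≢ p
    q≢p e = q∉P (subst (_∈ˢ P) (≡-sym e) p∈P)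
    back : ∀ x → x ∈ˢ P′ → x ≢ q → x ∈ˢ P × x ≢ p
    back x e x≢q with ∈⁻ e
    ... | inj₁ e′ = proj₁ (∈⁻ e′) , λ x≡p → proj₂ (∈⁻ {v = x} e′) (∈⁺ x≡p)
    ... | inj₂ e′ = contradiction (∈⁻ e′) x≢q
    P′⊆H′ : P′ ⊆ (H ∖ ⁅ p ⁆)
    P′⊆H′ v e with v Fin.≟ q
    ... | yes refl = ∈⁺ (q∈H , λ e′ → q≢p (∈⁻ e′))
    ... | no v≢q = ∈⁺ (P⊆H v (proj₁ (back v e v≢q)) , λ e′ → proj₂ (back v e v≢q) (∈⁻ e′))
    P′≤P : ∣ P′ ∣ ≤ ∣ P ∣
    P′≤P = ≤-trans (count-≤suc q (λ v e → [ inj₁ , (λ e′ → inj₂ (∈⁻ e′)) ]′ (∈⁻ e)))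
                   (count-∖⁅⁆ p p∈P)
    uns′ : Unseparated P′ Q (H ∖ ⁅ p ⁆)
    uns′ Y py yh = ≤-trans P′≤P bound
      where
      P⊆ : P ⊆ (Y ∪ ⁅ p ⁆)
      P⊆ = ⊆-insert {P} p Y (λ v e → py v (∈⁺ (inj₁ e)))
      ⊆H : (Y ∪ ⁅ p ⁆) ⊆ H
      ⊆H = insert-⊆ {H} p Y (P⊆H p p∈P) yh
      bound : ∣ P ∣ ≤ ∣ bd (H ∖ ⁅ p ⁆) Q Y ∣
      bound with any? (λ h → (h ∈? H) ×-dec ¬? (h ∈? (Y ∪ ⁅ p ⁆)))
      -- Here `Y` with `p` is a proper subset of `H` and contains `q` outside `P`. As it is not
      -- tight, its boundary exceeds `P`, and dropping `p` costs at most one.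
      ... | yes h = s≤s⁻¹ (≤-trans
              (≰⇒> (λ le → ¬tight ((Y ∪ ⁅ p ⁆) , P⊆ , ⊆H , le ,
                (q , ∈⁺ (inj₁ (py q (∈⁺ (inj₂ (∈⁺ refl))))) , q∉P) , h)))
              (count-≤suc p (bd-insert {H} {Q} p Y)))
      -- Here `Y` with `p` is all of `H`, so its boundary is contained in `Q` and does not contain
      -- `p`.
      ... | no ¬h = ≤-trans (uns (Y ∪ ⁅ p ⁆) P⊆ ⊆H) (count-mono sub′)
        where
        sub′ : bd H Q (Y ∪ ⁅ p ⁆) ⊆ bd (H ∖ ⁅ p ⁆) Q Y
        sub′ v e with ∈⁻ e
        ... | vy , inj₂ (u , _ , h , ¬y) = contradiction (u , h , ¬y) ¬h
        ... | vy , inj₁ v∈Q with ∈⁻ vy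
        ...   | inj₁ y = ∈⁺ (y , inj₁ v∈Q)
        ...   | inj₂ v≡p = contradiction (subst (_∈ˢ Q) (∈⁻ v≡p) v∈Q) p∉Q
    linkage = menger′ k P′ Q (H ∖ ⁅ p ⁆)
      (s≤s⁻¹ (<-≤-trans (count-∖⁅⁆ p (P⊆H p p∈P)) H≤k))
      P′⊆H′ uns′

  menger : ∀ {P Q H} → P ⊆ H → Unseparated P Q H → Linkage G P Q H
  menger {P} {Q} {H} = menger′ ∣ H ∣ P Q H ≤-refl

-- Sweeps and uncrossing.

-- A good set A is the union of the bags and of the components hanging off single bags of a path
-- decomposition of (G[A], S ∩ A) whose last bag contains the inner boundary ∂ A.
module Sweep (G : Graph) (S : VSet G) (N : ℕ) where

  private
    ∣_∣ : VSet G → ℕ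
    ∣ A ∣ = count (n G) A

  abstract
    ∂? : ∀ A → Decidable (λ v → v ∈ˢ A × ∃ λ u → Edge G v u × u ∉ˢ A)
    ∂? A v = (v ∈? A) ×-dec any? (λ u → edge? {G} v u ×-dec ¬? (u ∈? A))

  ∂ : VSet G → VSet G
  ∂ A = ⟦ ∂? A ⟧

  abstract
    bag? : ∀ A A′ → Decidable (λ v → v ∈ˢ A′ × (v ∈ˢ ∂ A ⊎ (v ∉ˢ A × (v ∈ˢ S ⊎ v ∈ˢ ∂ A′))))
    bag? A A′ v = (v ∈? A′) ×-dec ((v ∈? ∂ A) ⊎-dec (¬? (v ∈? A) ×-dec ((v ∈? S) ⊎-dec (v ∈? ∂ A′))))

  -- A new vertex left out of the bag is not in `S` and has all its neighbours in `A′`; those in `A`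
  -- belong to `∂ A`. So the left-out vertices hang off this single bag.
  bag : VSet G → VSet G → VSet G
  bag A A′ = ⟦ bag? A A′ ⟧

  data Good : VSet G → Set where
    base : ∀ {A} → (∀ v → v ∉ˢ A) → Good A
    step : ∀ {A A′} → Good A → A ⊆ A′ → ∣ bag A A′ ∣ ≤ N → Good A′

  ∂-ext : ∀ {A B} → A ⊆ B → B ⊆ A → ∂ A ⊆ ∂ B
  ∂-ext ab ba v e with ∈⁻ e
  ... | a , u , vu , ¬a = ∈⁺ (ab v a , u , vu , λ b → ¬a (ba u b))

  bag-ext : ∀ {A A′ B B′} → A ⊆ B → B ⊆ A → A′ ⊆ B′ → B′ ⊆ A′ → bag A A′ ⊆ bag B B′
  bag-ext ab ba ab′ ba′ v e with ∈⁻ e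
  ... | a′ , inj₁ p = ∈⁺ (ab′ v a′ , inj₁ (∂-ext ab ba v p))
  ... | a′ , inj₂ (¬a , inj₁ s) = ∈⁺ (ab′ v a′ , inj₂ ((λ b → ¬a (ba v b)) , inj₁ s))
  ... | a′ , inj₂ (¬a , inj₂ p) = ∈⁺ (ab′ v a′ , inj₂ ((λ b → ¬a (ba v b)) , inj₂ (∂-ext ab′ ba′ v p)))

  good-ext : Extensional Good
  good-ext ab ba (base ¬a) = base (λ v b → ¬a v (ba v b))
  good-ext ab ba (step g sub le) = step g (λ v a → ab v (sub v a))
    (≤-trans (count-mono (bag-ext (λ _ e → e) (λ _ e → e) ba ab)) le)

  -- Steps that add nothing can be dropped, so chains of length |A| suffice; this makes goodness decidable.
  Short : ℕ → VSet G → Set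
  Short zero    A = ∀ v → v ∉ˢ A
  Short (suc k) A = (∀ v → v ∉ˢ A) ⊎ ∃ λ B → Short k B × B ⊆ A × ∣ bag B A ∣ ≤ N

  short-ext : ∀ k → Extensional (Short k)
  short-ext zero    ab ba h        = λ v b → h v (ba v b)
  short-ext (suc k) ab ba (inj₁ h) = inj₁ (λ v b → h v (ba v b))
  short-ext (suc k) ab ba (inj₂ (B , s , sub , le)) = inj₂ (B , s , (λ v b → ab v (sub v b)) ,
    ≤-trans (count-mono (bag-ext (λ _ e → e) (λ _ e → e) ba ab)) le)

  short? : ∀ k → Decidable (Short k)
  short? zero    A = all? (λ v → ¬? (v ∈? A))
  short? (suc k) A = all? (λ v → ¬? (v ∈? A)) ⊎-dec anySet?
    (λ ab ba (s , sub , le) → short-ext k ab ba s , (λ v b → sub v (ba v b)) ,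
      ≤-trans (count-mono (bag-ext ba ab (λ _ e → e) (λ _ e → e))) le)
    (λ B → short? k B ×-dec (B ⊆? A) ×-dec (∣ bag B A ∣ ≤? N))

  short⇒good : ∀ k {A} → Short k A → Good A
  short⇒good zero    h        = base h
  short⇒good (suc k) (inj₁ h) = base h
  short⇒good (suc k) (inj₂ (B , s , sub , le)) = step (short⇒good k s) sub le

  good⇒short : ∀ {A} → Good A → ∀ k → ∣ A ∣ ≤ k → Short k A
  good⇒short (base h) zero    _ = h
  good⇒short (base h) (suc k) _ = inj₁ h
  good⇒short (step {A} {A′} g sub le) k A′≤k with A′ ⊆? A
  ... | yes A′⊆A = short-ext k sub A′⊆A (good⇒short g k (≤-trans (count-mono sub) A′≤k))
  ... | no A′⊈A with ⊈⇒∃ A′⊈A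
  good⇒short (step {A} {A′} g sub le) zero A′≤k | no _ | v , a′ , ¬a =
    contradiction (<-≤-trans (count-< sub v a′ ¬a) A′≤k) λ ()
  good⇒short (step {A} {A′} g sub le) (suc k) A′≤k | no _ | v , a′ , ¬a =
    inj₂ (A , good⇒short g k (s≤s⁻¹ (<-≤-trans (count-< sub v a′ ¬a) A′≤k)) , sub , le)

  good? : Decidable Good
  good? A = map′ (short⇒good ∣ A ∣) (λ g → good⇒short g ∣ A ∣ ≤-refl) (short? ∣ A ∣ A)

  -- Every bag of the chain for Y shrinks when the chain is intersected with X, by submodularity of ∣ ∂ _ ∣.
  uncross : ∀ {X Y} → Good Y → X ⊆ Y → (∀ Z → X ⊆ Z → Z ⊆ Y → ∣ ∂ X ∣ ≤ ∣ ∂ Z ∣) → Good X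
  uncross {X} {Y} good X⊆Y cut =
    good-ext (λ v e → proj₂ (∈⁻ e)) (λ v x → ∈⁺ (X⊆Y v x , x)) (go good (λ _ y → y))
    where
    bag∩ : ∀ {A A′} → A ⊆ A′ → ∀ v → v ∈ˢ bag (A ∩ X) (A′ ∩ X) → v ∈ˢ bag A A′ ⊎ v ∈ˢ ∂ X
    bag∩ sub v e with ∈⁻ e
    ... | ax , inj₁ p with ∈⁻ p
    ...   | a∩x , u , vu , ¬u with u ∈? X
    ...     | yes x = inj₁ (∈⁺ (proj₁ (∈⁻ ax) ,
                  inj₁ (∈⁺ (proj₁ (∈⁻ a∩x) , u , vu , λ a → ¬u (∈⁺ (a , x))))))
    ...     | no ¬x = inj₂ (∈⁺ (proj₂ (∈⁻ ax) , u , vu , ¬x))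
    bag∩ sub v e | ax , inj₂ (¬ax , inj₁ s) =
      inj₁ (∈⁺ (proj₁ (∈⁻ ax) , inj₂ ((λ a → ¬ax (∈⁺ (a , proj₂ (∈⁻ ax)))) , inj₁ s)))
    bag∩ sub v e | ax , inj₂ (¬ax , inj₂ p) with ∈⁻ p
    ... | _ , u , vu , ¬u with u ∈? X
    ...   | yes x = inj₁ (∈⁺ (proj₁ (∈⁻ ax) , inj₂ ((λ a → ¬ax (∈⁺ (a , proj₂ (∈⁻ ax)))) ,
                  inj₂ (∈⁺ (proj₁ (∈⁻ ax) , u , vu , λ a → ¬u (∈⁺ (a , x)))))))
    ...   | no ¬x = inj₂ (∈⁺ (proj₂ (∈⁻ ax) , u , vu , ¬x))
    ∂⇒bag : ∀ {A A′ v u} → v ∈ˢ A′ → A ⊆ A′ → Edge G v u → u ∉ˢ A′ → v ∈ˢ bag A A′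
    ∂⇒bag {A} {A′} {v} {u} a′ sub vu ¬u with v ∈? A
    ... | yes a = ∈⁺ (a′ , inj₁ (∈⁺ (a , u , vu , λ b → ¬u (sub u b))))
    ... | no ¬a = ∈⁺ (a′ , inj₂ (¬a , inj₂ (∈⁺ (a′ , u , vu , ¬u))))
    ∂∪ : ∀ {A A′} → A ⊆ A′ → ∀ v → v ∈ˢ ∂ (A′ ∪ X) → v ∈ˢ bag A A′ ⊎ v ∈ˢ ∂ X
    ∂∪ sub v e with ∈⁻ e
    ... | ax , u , vu , ¬u with ∈⁻ ax
    ...   | inj₁ a = inj₁ (∂⇒bag a sub vu (λ a′ → ¬u (∈⁺ (inj₁ a′))))
    ...   | inj₂ x = inj₂ (∈⁺ (x , u , vu , λ x′ → ¬u (∈⁺ (inj₂ x′))))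
    both : ∀ {A A′} → A ⊆ A′ → ∀ v → v ∈ˢ bag (A ∩ X) (A′ ∩ X) → v ∈ˢ ∂ (A′ ∪ X) →
           v ∈ˢ bag A A′ × v ∈ˢ ∂ X
    both sub v e e′ with ∈⁻ (proj₁ (∈⁻ e)) | ∈⁻ e′
    ... | a , x | _ , u , vu , ¬u =
      ∂⇒bag a sub vu (λ a′ → ¬u (∈⁺ (inj₁ a′))) , ∈⁺ (x , u , vu , λ x′ → ¬u (∈⁺ (inj₂ x′)))
    go : ∀ {A} → Good A → A ⊆ Y → Good (A ∩ X)
    go (base h) _ = base (λ v e → h v (proj₁ (∈⁻ e)))
    go (step {A} {A′} g sub le) A′⊆Y = step (go g (λ v a → A′⊆Y v (sub v a)))
      (λ v e → ∈⁺ (sub v (proj₁ (∈⁻ e)) , proj₂ (∈⁻ {v = v} e)))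
      -- Uncrossing bounds the new bag plus `∂ (A′ ∪ X)` by the old bag plus `∂ X`, and `∂ X` is no
      -- larger than `∂ (A′ ∪ X)`.
      (≤-trans (+-cancelʳ-≤ ∣ ∂ (A′ ∪ X) ∣ _ _
        (≤-trans (count-uncross (both sub) (bag∩ sub) (∂∪ sub)) (+-monoʳ-≤ _ cut′))) le)
      where
      cut′ : ∣ ∂ X ∣ ≤ ∣ ∂ (A′ ∪ X) ∣
      cut′ = cut (A′ ∪ X) (λ v x → ∈⁺ (inj₂ x)) (λ v e → [ A′⊆Y v , X⊆Y v ]′ (∈⁻ e))

  -- `Z` itself may fail to be good. A set of minimum boundary between `A` and `Y` is good by
  -- `uncross`, so `linked` applies to it.
  cut-bound : ∀ {A Y i} → Good Y → A ⊆ Y → (∀ B → Good B → A ⊆ B → i ≤ ∣ ∂ B ∣) →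
              ∀ Z → A ⊆ Z → Z ⊆ Y → i ≤ ∣ ∂ Z ∣
  cut-bound {A} {Y} {i} good A⊆Y linked Z A⊆Z Z⊆Y
    with argmin {Φ = λ Z → A ⊆ Z × Z ⊆ Y} (λ Z → ∣ ∂ Z ∣) (λ ab ba → count-mono (∂-ext ba ab))
      (λ ab ba (p , q) → (λ v a → ab v (p v a)) , (λ v b → q v (ba v b)))
      (λ Z → (A ⊆? Z) ×-dec (Z ⊆? Y)) (A , (λ _ a → a) , A⊆Y)
  ... | Z₀ , (A⊆Z₀ , Z₀⊆Y) , least = ≤-trans
    (linked Z₀ (uncross good Z₀⊆Y (λ B zb by → least B ((λ v a → zb v (A⊆Z₀ v a)) , by))) A⊆Z₀)
    (least Z (A⊆Z , Z⊆Y))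

  -- Maximality comes from minimising the size of the complement.
  maximal-good : ∀ {A i} → Good A → ∣ ∂ A ∣ ≤ i →
    ∃ λ B → A ⊆ B × Good B × ∣ ∂ B ∣ ≤ i × (∀ B′ → Good B′ → B ⊆ B′ → ∣ ∂ B′ ∣ ≤ i → B′ ⊆ B)
  maximal-good {A} {i} good A≤i
    with argmin {Φ = λ B → A ⊆ B × Good B × ∣ ∂ B ∣ ≤ i} (λ B → ∣ ⊤ˢ ∖ B ∣)
      (λ {A} {B} ab _ → count-mono {P = ⊤ˢ ∖ B} {⊤ˢ ∖ A} (λ v e → ∈⁺ (refl , λ a → proj₂ (∈⁻ {v = v} e) (ab v a))))
      (λ ab ba (p , g , le) → (λ v a → ab v (p v a)) , good-ext ab ba g , ≤-trans (count-mono (∂-ext ba ab)) le)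
      (λ B → (A ⊆? B) ×-dec good? B ×-dec (∣ ∂ B ∣ ≤? i)) (A , (λ _ a → a) , good , A≤i)
  ... | B , (A⊆B , g , le) , least = B , A⊆B , g , le , max
    where
    max : ∀ B′ → Good B′ → B ⊆ B′ → ∣ ∂ B′ ∣ ≤ i → B′ ⊆ B
    max B′ g′ B⊆B′ le′ v b′ with v ∈? B
    ... | yes b = b
    ... | no ¬b = contradiction b′ (proj₂ (∈⁻ {v = v} (count-≥⇒⊇
            (λ u e → ∈⁺ (refl , λ b → proj₂ (∈⁻ {v = u} e) (B⊆B′ u b)))
            (least B′ ((λ u a → B⊆B′ u (A⊆B u a)) , g′ , le′)) v (∈⁺ (refl , ¬b)))))

-- Partial models with roots.

-- A model of X[R] in G[A] whose branch sets, the fibres of `col`, all meet `Q`.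
record PartialModel (X G : Graph) (R : VSet X) (Q A : VSet G) : Set where
  field
    col    : Coloring G (n X)
    inside : ∀ v x → col v ≡ just x → x ∈ˢ R × v ∈ˢ A
    conn   : ∀ u v x → col u ≡ just x → col v ≡ just x → WalkIn G (fib {G = G} col x) u v
    meets  : ∀ x → x ∈ˢ R → ∃ λ w → w ∈ˢ Q × col w ≡ just x
    links  : ∀ x y → x ∈ˢ R → y ∈ˢ R → Edge X x y →
             ∃ λ g → ∃ λ h → col g ≡ just x × col h ≡ just y × Edge G g h

module _ {X G : Graph} {R : VSet X} where

  -- Each branch set swallows the linkage sets that start in it and thereby reaches `Q`.
  extend : ∀ {P Q H A A′} → PartialModel X G R P A → Linkage G P Q H →
           (∀ v → v ∈ˢ A → v ∈ˢ H → v ∈ˢ P) → A ⊆ A′ → H ⊆ A′ → PartialModel X G R Q A′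
  extend {P} {Q} {H} {A} {A′} M Λ A∩H⊆P A⊆A′ H⊆A′ = record
    { col = glue ; inside = λ v x e → inside′ v x (glue-inv v e) ; conn = conn′ ; meets = meets′ ; links = links′ }
    where
    open PartialModel M
    open Linkage Λ
    open Glue A col (λ v x e → proj₂ (inside v x e)) Λ A∩H⊆P
    inside′ : ∀ v x → _ → x ∈ˢ R × v ∈ˢ A′
    inside′ v x (inj₁ e) = proj₁ (inside v x e) , A⊆A′ v (proj₂ (inside v x e))
    inside′ v x (inj₂ (_ , p , e , e′)) = proj₁ (inside p x e′) , H⊆A′ v (proj₂ (sound v p e))
    back : ∀ v x → glue v ≡ just x → ∃ λ w → col w ≡ just x × WalkIn G (fib {G = G} glue x) v w
    back v x e with glue-inv v e
    ... | inj₁ e′ = v , e′ , here (∈⁺ e)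
    ... | inj₂ (_ , p , e′ , e″) = p , e″ , glue-walk-out v p e′ e″
    conn′ : ∀ u v x → glue u ≡ just x → glue v ≡ just x → WalkIn G (fib {G = G} glue x) u v
    conn′ u v x e e′ with back u x e | back v x e′
    ... | u′ , cu , wu | v′ , cv , wv =
      walk-trans wu (walk-trans (glue-walk-in (conn u′ v′ x cu cv)) (walk-sym wv))
    meets′ : ∀ x → x ∈ˢ R → ∃ λ w → w ∈ˢ Q × glue w ≡ just x
    meets′ x x∈R with meets x x∈R
    ... | w , w∈P , e with sink w w∈P
    ...   | q , q∈Q , e′ = q , q∈Q , glue-link q w e′ e
    links′ : ∀ x y → x ∈ˢ R → y ∈ˢ R → Edge X x y → _
    links′ x y x∈ y∈ xy with links x y x∈ y∈ xy
    ... | g , h , e , e′ , gh = g , h , glue-in g e , glue-in h e′ , gh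

  add-vertex : ∀ {Q A Q′ A′ x v} (M : PartialModel X G (R ∖ ⁅ x ⁆) Q A) → x ∈ˢ R → v ∉ˢ A →
               Q ⊆ Q′ → A ⊆ A′ → v ∈ˢ Q′ → v ∈ˢ A′ →
               (∀ y → y ∈ˢ (R ∖ ⁅ x ⁆) → Edge X x y → ∃ λ g → PartialModel.col M g ≡ just y × Edge G v g) →
               PartialModel X G R Q′ A′
  add-vertex {Q} {A} {Q′} {A′} {x} {v} M x∈R v∉A Q⊆ A⊆ v∈Q′ v∈A′ attach = record
    { col = col′ ; inside = inside′ ; conn = conn′ ; meets = meets′ ; links = links′ }
    where
    open PartialModel M
    col′ : Coloring G (n X)
    col′ u with u Fin.≟ v
    ... | yes _ = just x
    ... | no  _ = col u
    at : col′ v ≡ just x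
    at with v Fin.≟ v
    ... | yes _ = refl
    ... | no ¬e = contradiction refl ¬e
    old : ∀ u y → col u ≡ just y → col′ u ≡ just y
    old u y e with u Fin.≟ v
    ... | yes refl = contradiction (proj₂ (inside u y e)) v∉A
    ... | no _ = e
    inv : ∀ u y → col′ u ≡ just y → (u ≡ v × y ≡ x) ⊎ (col u ≡ just y × y ≢ x)
    inv u y e with u Fin.≟ v
    ... | yes u≡v = inj₁ (u≡v , ≡-sym (just-injective e))
    ... | no _ = inj₂ (e , λ y≡x → proj₂ (∈⁻ {v = y} (proj₁ (inside u y e))) (∈⁺ y≡x))
    inside′ : ∀ u y → col′ u ≡ just y → y ∈ˢ R × u ∈ˢ A′
    inside′ u y e with inv u y e
    ... | inj₁ (refl , refl) = x∈R , v∈A′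
    ... | inj₂ (e′ , _) = proj₁ (∈⁻ (proj₁ (inside u y e′))) , A⊆ u (proj₂ (inside u y e′))
    conn′ : ∀ u w y → col′ u ≡ just y → col′ w ≡ just y → WalkIn G (fib {G = G} col′ y) u w
    conn′ u w y e e′ with inv u y e | inv w y e′
    ... | inj₁ (refl , refl) | inj₁ (refl , _) = here (∈⁺ at)
    ... | inj₁ (_ , y≡x) | inj₂ (_ , y≢x) = contradiction y≡x y≢x
    ... | inj₂ (_ , y≢x) | inj₁ (_ , y≡x) = contradiction y≡x y≢x
    ... | inj₂ (cu , _) | inj₂ (cw , _) = walk-mono (λ z e″ → ∈⁺ (old z y (∈⁻ e″))) (conn u w y cu cw)
    rest : ∀ {y} → y ∈ˢ R → y ≢ x → y ∈ˢ (R ∖ ⁅ x ⁆)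
    rest y∈R y≢x = ∈⁺ (y∈R , λ e → y≢x (∈⁻ e))
    meets′ : ∀ y → y ∈ˢ R → ∃ λ w → w ∈ˢ Q′ × col′ w ≡ just y
    meets′ y y∈R with y Fin.≟ x
    ... | yes refl = v , v∈Q′ , at
    ... | no y≢x with meets y (rest y∈R y≢x)
    ...   | w , w∈Q , e = w , Q⊆ w w∈Q , old w y e
    links′ : ∀ y z → y ∈ˢ R → z ∈ˢ R → Edge X y z →
             ∃ λ g → ∃ λ h → col′ g ≡ just y × col′ h ≡ just z × Edge G g h
    links′ y z y∈R z∈R yz with y Fin.≟ x | z Fin.≟ x
    ... | yes refl | yes refl = contradiction (trans (≡-sym yz) (irrefl X y)) λ ()
    ... | yes refl | no z≢x with attach z (rest z∈R z≢x) yz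
    ...   | g , e , vg = v , g , at , old g z e , vg
    links′ y z y∈R z∈R yz | no y≢x | yes refl with attach y (rest y∈R y≢x) (edge-sym {X} yz)
    ...   | g , e , vg = g , v , old g y e , at , edge-sym {G} vg
    links′ y z y∈R z∈R yz | no y≢x | no z≢x with links y z (rest y∈R y≢x) (rest z∈R z≢x) yz
    ...   | g , h , e , e′ , gh = g , h , old g y e , old h z e′ , gh

-- Rooted models of a forest.

-- Vertices isolated in X[R] count as leaves.
Leaf : (X : Graph) → VSet X → V X → Set
Leaf X R x = x ∈ˢ R × (∀ y z → y ∈ˢ R → z ∈ˢ R → Edge X x y → Edge X x z → y ≡ z)

-- That X[F] is a forest enters only through `leaf`. The bound `k≤N` serves the bags that add one
-- vertex, and `2k≤1+N` the bag made of a boundary and a cut of at most `k` - 1 vertices.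
module Rooted {X : Graph} (F : VSet X)
              (leaf : ∀ R → R ⊆ F → ∃ (_∈ˢ R) → ∃ (Leaf X R))
              (k N : ℕ) (F≤k : count (n X) F ≤ k) (k≤N : k ≤ N) (2k≤1+N : k + k ≤ suc N)
              (G : Graph) (S : VSet G) where
  open Sweep G S N
  open Menger G using (bd; Unseparated)
  open MengerProof G using (menger)

  private
    ∣_∣ : VSet G → ℕ
    ∣ A ∣ = count (n G) A

  -- With `linked` applied to `A` itself, the boundary has exactly as many vertices as `R`, one in
  -- each branch set. For larger good sets `linked` supplies the hypothesis of Menger's theorem.
  record State (R : VSet X) : Set where
    field
      A      : VSet G
      good   : Good A
      small  : ∣ ∂ A ∣ ≤ count (n X) R
      linked : ∀ B → Good B → A ⊆ B → count (n X) R ≤ ∣ ∂ B ∣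
      model  : PartialModel X G R (∂ A) A

  beyond : VSet G → VSet G
  beyond A = (⊤ˢ ∖ A) ∪ ∂ A

  A∩beyond⊆∂ : ∀ {A} v → v ∈ˢ A → v ∈ˢ beyond A → v ∈ˢ ∂ A
  A∩beyond⊆∂ v a e with ∈⁻ e
  ... | inj₁ e′ = contradiction a (proj₂ (∈⁻ {v = v} e′))
  ... | inj₂ e′ = e′

  -- A maximal good set with small boundary replaces `A`, and a linkage drags the roots to its
  -- boundary. For the linkage, `cut-bound` is applied to `A ∪ Z`, whose boundary lies in the cut
  -- given by `Z`.
  enlarge : ∀ {R} → State R → Σ (State R) λ s →
            ∀ B → Good B → State.A s ⊆ B → ∣ ∂ B ∣ ≤ count (n X) R → B ⊆ State.A s
  enlarge {R} s with maximal-good (State.good s) (State.small s)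
  ... | B , A⊆B , goodB , small , max = record
    { A = B ; good = goodB ; small = small
    ; linked = λ C g BC → linked C g (λ v a → BC v (A⊆B v a))
    ; model = extend model linkage (λ v a h → A∩beyond⊆∂ v a (proj₂ (∈⁻ h))) A⊆B (λ v h → proj₁ (∈⁻ h))
    } , max
    where
    open State s using (A; linked; model; good) renaming (small to smallA)
    H = B ∩ beyond A
    uns : Unseparated (∂ A) (∂ B) H
    uns Z PZ ZH = ≤-trans smallA (≤-trans
      (cut-bound goodB A⊆B linked (A ∪ Z) (λ v a → ∈⁺ (inj₁ a)) AZ⊆B) (count-mono sub))
      where
      AZ⊆B : (A ∪ Z) ⊆ B
      AZ⊆B v e with ∈⁻ e
      ... | inj₁ a = A⊆B v a
      ... | inj₂ z = proj₁ (∈⁻ (ZH v z))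
      sub : ∂ (A ∪ Z) ⊆ bd H (∂ B) Z
      sub v e with ∈⁻ e
      ... | az , u , vu , ¬u = ∈⁺ (v∈Z (∈⁻ az) , out)
        where
        v∈Z : v ∈ˢ A ⊎ v ∈ˢ Z → v ∈ˢ Z
        v∈Z (inj₁ a) = PZ v (∈⁺ (a , u , vu , λ a′ → ¬u (∈⁺ (inj₁ a′))))
        v∈Z (inj₂ z) = z
        out : _ ⊎ _
        out with u ∈? B
        ... | yes b = inj₂ (u , vu , ∈⁺ (b , ∈⁺ (inj₁ (∈⁺ (refl , λ a → ¬u (∈⁺ (inj₁ a)))))) ,
                            λ z → ¬u (∈⁺ (inj₂ z)))
        ... | no ¬b = inj₁ (∈⁺ (AZ⊆B v az , u , vu , ¬b))
    linkage = menger (λ v p → ∈⁺ (A⊆B v (proj₁ (∈⁻ p)) , ∈⁺ (inj₂ p))) uns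

  module _ (¬good : ¬ Good ⊤ˢ) where

    outside : ∀ {A} → Good A → ∃ λ v → v ∉ˢ A
    outside g with ⊈⇒∃ {P = ⊤ˢ} (λ ⊤⊆A → ¬good (good-ext (λ _ _ → refl) ⊤⊆A g))
    ... | v , _ , ¬a = v , ¬a

    -- The step adds the single vertex `v` to `A`, as the branch set of the leaf `x`. By maximality
    -- every good set containing `A` and `v` has a boundary larger than the old bound, which renews
    -- `linked`.
    module Grow {R : VSet X} {x : V X} (x∈R : x ∈ˢ R) (R⊆F : R ⊆ F) (s : State (R ∖ ⁅ x ⁆))
                (max : ∀ B → Good B → State.A s ⊆ B → ∣ ∂ B ∣ ≤ count (n X) (R ∖ ⁅ x ⁆) → B ⊆ State.A s)
                (v : V G) (v∉A : v ∉ˢ State.A s)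
                (attached : ∀ y → y ∈ˢ (R ∖ ⁅ x ⁆) → Edge X x y →
                            ∃ λ g → PartialModel.col (State.model s) g ≡ just y × Edge G v g) where
      open State s
      open PartialModel model
      R₀ : VSet X
      R₀ = R ∖ ⁅ x ⁆
      R₀<R : count (n X) R₀ < count (n X) R
      R₀<R = count-∖⁅⁆ x x∈R
      R≤ : count (n X) R ≤ suc (count (n X) R₀)
      R≤ = count-≤suc x split
        where
        split : ∀ y → y ∈ˢ R → y ∈ˢ R₀ ⊎ y ≡ x
        split y r with y Fin.≟ x
        ... | yes e = inj₂ e
        ... | no ¬e = inj₁ (∈⁺ (r , λ e → ¬e (∈⁻ e)))
      A′ ∂A+ : VSet G
      A′ = A ∪ ⁅ v ⁆
      ∂A+ = ∂ A ∪ ⁅ v ⁆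
      A⊆A′ : A ⊆ A′
      A⊆A′ u a = ∈⁺ (inj₁ a)
      ∂A+≤ : ∣ ∂A+ ∣ ≤ count (n X) R
      ∂A+≤ = ≤-trans (count-≤suc v (λ u e → [ inj₁ , (λ e′ → inj₂ (∈⁻ e′)) ]′ (∈⁻ e))) (≤-trans (s≤s small) R₀<R)
      ∂A′⊆ : ∂ A′ ⊆ ∂A+
      ∂A′⊆ u e with ∈⁻ e
      ... | a′ , w , uw , ¬w with ∈⁻ a′
      ...   | inj₁ a = ∈⁺ (inj₁ (∈⁺ (a , w , uw , λ a″ → ¬w (∈⁺ (inj₁ a″)))))
      ...   | inj₂ u≡v = ∈⁺ (inj₂ u≡v)
      bag⊆ : bag A A′ ⊆ ∂A+
      bag⊆ u e = ∈⁺ (out (∈⁻ e))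
        where
        out : _ → u ∈ˢ ∂ A ⊎ u ∈ˢ ⁅ v ⁆
        out (_ , inj₁ p) = inj₁ p
        out (a′ , inj₂ (¬a , _)) = [ (λ a → contradiction a ¬a) , inj₂ ]′ (∈⁻ a′)
      bag≤ : ∣ bag A A′ ∣ ≤ ∣ ∂A+ ∣
      bag≤ = count-mono bag⊆
      bag≤N : ∣ bag A A′ ∣ ≤ N
      bag≤N = ≤-trans bag≤ (≤-trans ∂A+≤ (≤-trans (count-mono R⊆F) (≤-trans F≤k k≤N)))
      good′ : Good A′
      good′ = step good A⊆A′ bag≤N
      v∈⁅v⁆ : v ∈ˢ ⁅ v ⁆
      v∈⁅v⁆ = ∈⁺ refl
      v∈A′ : v ∈ˢ A′
      v∈A′ = ∈⁺ (inj₂ v∈⁅v⁆)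
      linked′ : ∀ B → Good B → A′ ⊆ B → count (n X) R ≤ ∣ ∂ B ∣
      linked′ B g A′⊆B = ≤-trans R≤ (≰⇒> too-small)
        where
        too-small : ∣ ∂ B ∣ ≤ count (n X) R₀ → ⊥
        too-small le = v∉A (max B g (λ u a → A′⊆B u (A⊆A′ u a)) le v (A′⊆B v v∈A′))
      small′ : ∣ ∂ A′ ∣ ≤ count (n X) R
      small′ = ≤-trans (count-mono ∂A′⊆) ∂A+≤
      -- `∂ A′` lies in `∂A+` and is at least as large, so the two agree: no old root leaves the
      -- boundary, and `v` is on it.
      ∂A⊆ : ∂A+ ⊆ ∂ A′
      ∂A⊆ = count-≥⇒⊇ ∂A′⊆ (≤-trans ∂A+≤ (linked′ A′ good′ (λ _ a → a)))
      ∂⊆ : ∂ A ⊆ ∂ A′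
      ∂⊆ u e = ∂A⊆ u (∈⁺ (inj₁ e))
      grown : State R
      grown = record
        { A = A′ ; good = good′ ; small = small′ ; linked = linked′
        ; model = add-vertex model x∈R v∉A ∂⊆ A⊆A′ (∂A⊆ v (∈⁺ (inj₂ v∈⁅v⁆))) v∈A′ attached
        }

    -- The root of the only neighbour of `x` in `R` lies on the boundary and so has a neighbour
    -- outside `A`. If `x` has no neighbour there, any vertex outside `A` will do.
    attachment : ∀ {R x} → Leaf X R x → (s : State (R ∖ ⁅ x ⁆)) →
      ∃ λ v → v ∉ˢ State.A s × (∀ y → y ∈ˢ (R ∖ ⁅ x ⁆) → Edge X x y →
                                ∃ λ g → PartialModel.col (State.model s) g ≡ just y × Edge G v g)
    attachment {R} {x} (x∈R , unique) s = choose (any? (λ y → (y ∈? (R ∖ ⁅ x ⁆)) ×-dec edge? {X} x y))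
      where
      open State s
      open PartialModel model
      Attached : V G → Set
      Attached v = ∀ y → y ∈ˢ (R ∖ ⁅ x ⁆) → Edge X x y → ∃ λ g → col g ≡ just y × Edge G v g
      beside : ∀ y → y ∈ˢ (R ∖ ⁅ x ⁆) → Edge X x y → ∀ w → col w ≡ just y →
               (w ∈ˢ A × ∃ λ v → Edge G w v × v ∉ˢ A) → ∃ λ v → v ∉ˢ A × Attached v
      beside y y∈ xy w e (_ , v , wv , v∉A) = v , v∉A , λ z z∈ xz → w ,
        trans e (cong just (unique y z (proj₁ (∈⁻ y∈)) (proj₁ (∈⁻ z∈)) xy xz)) , edge-sym {G} wv
      choose : Dec (∃ λ y → y ∈ˢ (R ∖ ⁅ x ⁆) × Edge X x y) → ∃ λ v → v ∉ˢ A × Attached v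
      choose (no none) = proj₁ (outside good) , proj₂ (outside good) , λ y y∈ xy → contradiction (y , y∈ , xy) none
      choose (yes (y , y∈ , xy)) = beside y y∈ xy (proj₁ met) (proj₂ (proj₂ met)) (∈⁻ (proj₁ (proj₂ met)))
        where
        met : ∃ λ w → w ∈ˢ ∂ A × col w ≡ just y
        met = meets y y∈

    grow : ∀ {R x} → Leaf X R x → R ⊆ F → State (R ∖ ⁅ x ⁆) → State R
    grow l R⊆F s₀ = Grow.grown (proj₁ l) R⊆F (proj₁ big) (proj₂ big) (proj₁ p) (proj₁ (proj₂ p)) (proj₂ (proj₂ p))
      where
      big = enlarge s₀
      p = attachment l (proj₁ big)

    state : ∀ m R → count (n X) R ≤ m → R ⊆ F → State R
    state m R R≤m R⊆F with any? (_∈? R)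
    ... | no R=∅ = record
      { A = ∅ˢ ; good = base (λ _ ())
      ; small = ≤-trans (≤-reflexive (count-empty {P = ∂ ∅ˢ} (λ v e → contradiction (proj₁ (∈⁻ {v = v} e)) λ ()))) z≤n
      ; linked = λ B _ _ → ≤-trans (≤-reflexive (count-empty (λ x r → R=∅ (x , r)))) z≤n
      ; model = record
        { col = λ _ → nothing ; inside = λ _ _ () ; conn = λ _ _ _ ()
        ; meets = λ x r → contradiction (x , r) R=∅
        ; links = λ x _ r → contradiction (x , r) R=∅ } }
    ... | yes R≠∅ with leaf R R⊆F R≠∅
    state zero R R≤m R⊆F | yes _ | x , x∈R , _ =
      contradiction R≤m (∈⇒count≰0 x x∈R)
    state (suc m) R R≤m R⊆F | yes _ | x , l = grow l R⊆F (state m (R ∖ ⁅ x ⁆)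
      (s≤s⁻¹ (<-≤-trans (count-∖⁅⁆ x (proj₁ l)) R≤m))
      (λ v e → R⊆F v (proj₁ (∈⁻ e))))

    rooted-model : PartialModel X G F S ⊤ˢ
    rooted-model = extend model (menger (λ v p → ∈⁺ (inj₂ p)) uns) A∩beyond⊆∂ (λ _ _ → refl) (λ _ _ → refl)
      where
      open State (state (count (n X) F) F ≤-refl (λ _ e → e))
      uns : Unseparated (∂ A) S (beyond A)
      uns Z PZ ZH with ∣ ∂ A ∣ ≤? ∣ bd (beyond A) S Z ∣
      ... | yes le = le
      -- A cut smaller than `∂ A` would make `A ∪ Z` good, with its boundary inside the cut, against
      -- `linked`.
      ... | no ¬le = contradiction
            (≤-trans small (≤-trans (linked (A ∪ Z) good′ (λ v a → ∈⁺ (inj₁ a))) (count-mono ∂⊆bd))) ¬le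
        where
        bd⁺ : ∀ {u v} → v ∈ˢ Z → Edge G v u → u ∉ˢ (A ∪ Z) → v ∈ˢ bd (beyond A) S Z
        bd⁺ z vu ¬u = ∈⁺ (z , inj₂ (_ , vu ,
          ∈⁺ (inj₁ (∈⁺ (refl , λ a → ¬u (∈⁺ (inj₁ a))))) , λ z′ → ¬u (∈⁺ (inj₂ z′))))
        ∂⊆bd : ∂ (A ∪ Z) ⊆ bd (beyond A) S Z
        ∂⊆bd v e with ∈⁻ e
        ... | az , u , vu , ¬u with ∈⁻ az
        ...   | inj₂ z = bd⁺ z vu ¬u
        ...   | inj₁ a = bd⁺ (PZ v (∈⁺ (a , u , vu , λ a′ → ¬u (∈⁺ (inj₁ a′))))) vu ¬u
        bag⊆ : ∀ v → v ∈ˢ bag A (A ∪ Z) → v ∈ˢ ∂ A ⊎ v ∈ˢ bd (beyond A) S Z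
        bag⊆ v e with ∈⁻ e
        ... | _ , inj₁ p = inj₁ p
        ... | az , inj₂ (¬a , w) with ∈⁻ az
        ...   | inj₁ a = contradiction a ¬a
        ...   | inj₂ z with w
        ...     | inj₁ s = inj₂ (∈⁺ (z , inj₁ s))
        ...     | inj₂ p = inj₂ (∂⊆bd v p)
        -- The bag has at most `k` + (`k` - 1) vertices, from `∂ A` and the cut.
        good′ : Good (A ∪ Z)
        good′ = step good (λ v a → ∈⁺ (inj₁ a)) (s≤s⁻¹ (≤-trans
          (s≤s (count-∪ bag⊆)) (≤-trans (≤-reflexive (≡-sym (+-suc _ _)))
          (≤-trans (+-mono-≤ (≤-trans small F≤k) (≤-trans (≰⇒> ¬le) (≤-trans small F≤k))) 2k≤1+N))))

-- From good sets to interval representations.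

if-in : ∀ {B : Set} {A : BSet d} {v : Fin d} {x y : B} → v ∈ˢ A → (if A v then x else y) ≡ x
if-in e rewrite e = refl

if-out : ∀ {B : Set} {A : BSet d} {v : Fin d} {x y : B} → v ∉ˢ A → (if A v then x else y) ≡ y
if-out {A = A} {v} ¬e rewrite ¬-not {A v} {true} ¬e = refl

-- A path decomposition given by the intervals [l v , r v] of bag indices. The bags are made of core vertices;
-- every component of the rest sits in the single position l v ≡ r v of its vertices.
record Core (G : Graph) (S : VSet G) (N : ℕ) : Set where
  field
    core    : VSet G
    l r     : V G → ℕ
    T       : ℕ
    l≤r     : ∀ v → l v ≤ r v
    r<T     : ∀ v → r v < T
    thin    : ∀ v → v ∉ˢ core → r v ≡ l v
    S⊆core  : S ⊆ core
    touch : ∀ u v → Edge G u v → l u ≤ r v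
    width   : ∀ t → count (n G) ⟦ (λ v → (v ∈? core) ×-dec (l v ≤? t) ×-dec (t ≤? r v)) ⟧ ≤ N

module _ {G : Graph} {S : VSet G} {N : ℕ} where
  open Sweep G S N

  -- The version for a partly swept graph; `boundary` keeps `∂ A` in the last bag, from which the
  -- next one continues.
  record CoreOn (A : VSet G) : Set where
    field
      core     : VSet G
      l r      : V G → ℕ
      T        : ℕ
      l≤r      : ∀ v → v ∈ˢ A → l v ≤ r v
      r<T      : ∀ v → v ∈ˢ A → r v < T
      thin     : ∀ v → v ∈ˢ A → v ∉ˢ core → r v ≡ l v
      S⊆core   : ∀ v → v ∈ˢ A → v ∈ˢ S → v ∈ˢ core
      touch  : ∀ u v → u ∈ˢ A → v ∈ˢ A → Edge G u v → l u ≤ r v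
      width    : ∀ t → count (n G) ⟦ (λ v → (v ∈? A) ×-dec (v ∈? core) ×-dec (l v ≤? t) ×-dec (t ≤? r v)) ⟧ ≤ N
      boundary : ∀ v → v ∈ˢ ∂ A → v ∈ˢ core × suc (r v) ≡ T

  -- Position `T` is appended: vertices of `∂ A` are prolonged to it, new vertices occupy it alone,
  -- and all others keep their intervals.
  module NextBag {A A′ : VSet G} (D : CoreOn A) (A⊆A′ : A ⊆ A′) (bag≤N : count (n G) (bag A A′) ≤ N) where
    open CoreOn D

    ∂′∩A : ∀ v → v ∈ˢ A → v ∈ˢ ∂ A′ → v ∈ˢ ∂ A
    ∂′∩A v a e = ∈⁺ (a , proj₁ w , proj₁ (proj₂ w) , λ b → proj₂ (proj₂ w) (A⊆A′ _ b))
      where w = proj₂ (∈⁻ e)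

    core′ settled : VSet G
    core′ v = if A v then core v else ⟦ ∪? S (∂ A′) ⟧ v
    settled = A ∖ ∂ A
    l′ r′ : V G → ℕ
    l′ v = if A v then l v else T
    r′ v = if settled v then r v else T

    data Place (v : V G) : Set where
      before : v ∈ˢ A → v ∉ˢ ∂ A → core′ v ≡ core v → l′ v ≡ l v → r′ v ≡ r v → Place v
      edge   : v ∈ˢ A → v ∈ˢ ∂ A → core′ v ≡ core v → l′ v ≡ l v → r′ v ≡ T → Place v
      new    : v ∉ˢ A → core′ v ≡ (S ∪ ∂ A′) v → l′ v ≡ T → r′ v ≡ T → Place v

    place : ∀ v → Place v
    place v with v ∈? A | v ∈? ∂ A
    ... | yes a | yes p = edge a p (if-in {A = A} a) (if-in {A = A} a) (if-out {A = settled} (λ e → proj₂ (∈⁻ {v = v} e) p))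
    ... | yes a | no ¬p = before a ¬p (if-in {A = A} a) (if-in {A = A} a) (if-in {A = settled} (∈⁺ (a , ¬p)))
    ... | no ¬a | _     = new ¬a (if-out {A = A} ¬a) (if-out {A = A} ¬a) (if-out {A = settled} (λ e → ¬a (proj₁ (∈⁻ {v = v} e))))

    l<T : ∀ v → v ∈ˢ A → l v < T
    l<T v a = ≤-<-trans (l≤r v a) (r<T v a)

    l≤r′ : ∀ v → l′ v ≤ r′ v
    l≤r′ v with place v
    ... | before a _ _ el er rewrite el | er = l≤r v a
    ... | edge a _ _ el er rewrite el | er = <⇒≤ (l<T v a)
    ... | new _ _ el er rewrite el | er = ≤-refl

    r<T′ : ∀ v → r′ v < suc T
    r<T′ v with place v
    ... | before a _ _ el er rewrite er = m≤n⇒m≤1+n (r<T v a)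
    ... | edge a _ _ el er rewrite er = ≤-refl
    ... | new _ _ el er rewrite er = ≤-refl

    thin′ : ∀ v → v ∉ˢ core′ → r′ v ≡ l′ v
    thin′ v ¬c with place v
    ... | before a _ ec el er rewrite ec | el | er = thin v a ¬c
    ... | edge a p ec el er rewrite ec = contradiction (proj₁ (boundary v p)) ¬c
    ... | new _ _ el er = trans er (≡-sym el)

    S⊆core′ : ∀ v → v ∈ˢ S → v ∈ˢ core′
    S⊆core′ v s with place v
    ... | before a _ ec _ _ rewrite ec = S⊆core v a s
    ... | edge a _ ec _ _ rewrite ec = S⊆core v a s
    ... | new _ ec _ _ = trans ec (∈⁺ (inj₁ s))

    touch′ : ∀ u v → Edge G u v → l′ u ≤ r′ v
    touch′ u v uv with place u | place v
    ... | before a _ _ el _ | before b _ _ _ er rewrite el | er = touch u v a b uv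
    ... | edge a _ _ el _   | before b _ _ _ er rewrite el | er = touch u v a b uv
    ... | before a _ _ el _ | edge _ _ _ _ er rewrite el | er = <⇒≤ (l<T u a)
    ... | edge a _ _ el _   | edge _ _ _ _ er rewrite el | er = <⇒≤ (l<T u a)
    ... | before a _ _ el _ | new _ _ _ er rewrite el | er = <⇒≤ (l<T u a)
    ... | edge a _ _ el _   | new _ _ _ er rewrite el | er = <⇒≤ (l<T u a)
    ... | new _ _ el _      | edge _ _ _ _ er rewrite el | er = ≤-refl
    ... | new _ _ el _      | new _ _ _ er rewrite el | er = ≤-refl
    ... | new ¬a _ _ _      | before b ¬p _ _ _ = contradiction (∈⁺ (b , u , edge-sym {G} uv , ¬a)) ¬p

    boundary′ : ∀ v → v ∈ˢ ∂ A′ → v ∈ˢ core′ × suc (r′ v) ≡ 1 + T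
    boundary′ v e with place v
    ... | before a ¬p _ _ _ = contradiction (∂′∩A v a e) ¬p
    ... | edge a p ec _ er = trans ec (proj₁ (boundary v p)) , cong suc er
    ... | new _ ec _ er = trans ec (∈⁺ (inj₂ e)) , cong suc er

    late⊆bag : ∀ {t v} → T ≤ t → v ∈ˢ A′ → v ∈ˢ core′ → t ≤ r′ v → v ∈ˢ bag A A′
    late⊆bag {t} {v} T≤t a′ c t≤r with place v
    ... | before a _ _ _ er rewrite er = contradiction (≤-trans T≤t t≤r) (<⇒≱ (r<T v a))
    ... | edge a p _ _ _ = ∈⁺ (a′ , inj₁ p)
    ... | new ¬a ec _ _ = ∈⁺ (a′ , inj₂ (¬a , ∈⁻ (trans (≡-sym ec) c)))

    early⊆old : ∀ {t v} → t < T → v ∈ˢ core′ → l′ v ≤ t → t ≤ r′ v → v ∈ˢ A × v ∈ˢ core × l v ≤ t × t ≤ r v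
    early⊆old {t} {v} t<T c l≤t t≤r with place v
    ... | before a _ ec el er rewrite ec | el | er = a , c , l≤t , t≤r
    -- A boundary vertex already reached position `T` - 1, so below `T` its interval is unchanged.
    ... | edge a p ec el er rewrite ec | el = a , c , l≤t , s≤s⁻¹ (≤-trans t<T (≤-reflexive (≡-sym (proj₂ (boundary v p)))))
    ... | new _ _ el _ rewrite el = contradiction l≤t (<⇒≱ t<T)

    width′ : ∀ t → count (n G) ⟦ (λ v → (v ∈? A′) ×-dec (v ∈? core′) ×-dec (l′ v ≤? t) ×-dec (t ≤? r′ v)) ⟧ ≤ N
    width′ t with t <? T
    ... | yes t<T = ≤-trans (count-mono {k = n G} (λ v e → ∈⁺ (old (∈⁻ e)))) (width t)
      where
      old : ∀ {v} → v ∈ˢ A′ × v ∈ˢ core′ × l′ v ≤ t × t ≤ r′ v → v ∈ˢ A × v ∈ˢ core × l v ≤ t × t ≤ r v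
      old (_ , c , l≤t , t≤r) = early⊆old t<T c l≤t t≤r
    ... | no t≮T = ≤-trans (count-mono {k = n G} (λ v e → inbag (∈⁻ e))) bag≤N
      where
      inbag : ∀ {v} → v ∈ˢ A′ × v ∈ˢ core′ × l′ v ≤ t × t ≤ r′ v → v ∈ˢ bag A A′
      inbag (a′ , c , _ , t≤r) = late⊆bag (≮⇒≥ t≮T) a′ c t≤r

    next : CoreOn A′
    next = record
      { core = core′ ; l = l′ ; r = r′ ; T = suc T
      ; l≤r = λ v _ → l≤r′ v ; r<T = λ v _ → r<T′ v ; thin = λ v _ → thin′ v
      ; S⊆core = λ v _ → S⊆core′ v ; touch = λ u v _ _ → touch′ u v ; width = width′ ; boundary = boundary′ }

  good⇒coreOn : ∀ {A} → Good A → CoreOn A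
  good⇒coreOn (base ¬a) = record
    { core = ∅ˢ ; l = λ _ → 0 ; r = λ _ → 0 ; T = 0
    ; l≤r = λ _ _ → z≤n ; r<T = λ v a → contradiction a (¬a v) ; thin = λ _ _ _ → refl
    ; S⊆core = λ v a → contradiction a (¬a v) ; touch = λ _ _ _ _ _ → z≤n
    ; width = λ t → ≤-trans (≤-reflexive (count-empty {k = n G} (λ v e → ¬a v (proj₁ (∈⁻ e))))) z≤n
    ; boundary = λ v e → contradiction (proj₁ (∈⁻ e)) (¬a v) }
  good⇒coreOn (step g sub le) = NextBag.next (good⇒coreOn g) sub le

  good⇒core : Good ⊤ˢ → Core G S N
  good⇒core g = record
    { core = core ; l = l ; r = r ; T = T
    ; l≤r = λ v → l≤r v refl ; r<T = λ v → r<T v refl ; thin = λ v → thin v refl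
    ; S⊆core = λ v → S⊆core v refl ; touch = λ u v → touch u v refl refl
    ; width = λ t → ≤-trans (count-mono {k = n G} (λ v e → ∈⁺ (refl , ∈⁻ e))) (width t) }
    where open CoreOn (good⇒coreOn g)

-- Induced subgraphs and components.

-- The vertex set is kept and vertices outside `C` become isolated, so vertex sets and colourings
-- carry over unchanged.
restrict : (G : Graph) → VSet G → Graph
restrict G C = record
  { n = n G
  ; adj = λ u v → adj G u v ∧ (C u ∧ C v)
  ; sym = λ u v → cong₂ _∧_ (Graph.sym G u v) (∧-comm (C u) (C v))
  ; irrefl = λ u → cong (_∧ (C u ∧ C u)) (irrefl G u) }

module _ {G : Graph} {C : VSet G} where

  restrict⁺ : ∀ {u v} → u ∈ˢ C → v ∈ˢ C → Edge G u v → Edge (restrict G C) u v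
  restrict⁺ c c′ e rewrite c | c′ | e = refl

  restrict⁻ : ∀ {u v} → Edge (restrict G C) u v → u ∈ˢ C × v ∈ˢ C × Edge G u v
  restrict⁻ {u} {v} e with adj G u v | C u | C v
  ... | true | true | true = refl , refl , refl

  unrestrict-walk : ∀ {B u v} → WalkIn (restrict G C) B u v → WalkIn G B u v
  unrestrict-walk (here p)     = here p
  unrestrict-walk (step p e w) = step p (proj₂ (proj₂ (restrict⁻ e))) (unrestrict-walk w)

record Rooted∈ (G : Graph) (K : VSet G) : Set where
  field
    root  : V G
    root∈ : root ∈ˢ K
    walks : ∀ v → v ∈ˢ K → WalkIn G K v root

  connected : NonEmptyConnected G K
  connected = (root , root∈) , λ u v u∈ v∈ → walk-trans (walks u u∈) (walk-sym (walks v v∈))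

module _ {G : Graph} where

  record Component (K B : VSet G) : Set where
    field
      K⁺     : VSet G
      K⊆     : K ⊆ K⁺
      ⊆B     : K⁺ ⊆ B
      rooted : Rooted∈ G K⁺
      closed : ∀ u v → u ∈ˢ K⁺ → v ∈ˢ B → Edge G u v → v ∈ˢ K⁺

  component : ∀ i {K B} → count (n G) (B ∖ K) ≤ i → K ⊆ B → Rooted∈ G K → Component K B
  component i {K} {B} le K⊆B R
    with any? (λ v → (v ∈? (B ∖ K)) ×-dec any? (λ u → (u ∈? K) ×-dec edge? {G} u v))
  ... | no none = record { K⁺ = K ; K⊆ = λ _ k → k ; ⊆B = K⊆B ; rooted = R ; closed = closed }
    where
    closed : ∀ u v → u ∈ˢ K → v ∈ˢ B → Edge G u v → v ∈ˢ K
    closed u v k b e with v ∈? K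
    ... | yes k′ = k′
    ... | no ¬k′ = contradiction (v , ∈⁺ (b , ¬k′) , u , k , e) none
  component zero le K⊆B R | yes (v , v∈ , _) =
    contradiction le (∈⇒count≰0 v v∈)
  component (suc i) {K} {B} le K⊆B R | yes (v , v∈ , u , u∈K , uv) = record
    { K⁺ = K⁺ ; K⊆ = λ w k → K⊆ w (K⊆K′ w k) ; ⊆B = ⊆B ; rooted = rooted ; closed = closed }
    where
    K′ : VSet G
    K′ = K ∪ ⁅ v ⁆
    v∈⁅v⁆ : v ∈ˢ ⁅ v ⁆
    v∈⁅v⁆ = ∈⁺ refl
    v∈K′ : v ∈ˢ K′
    v∈K′ = ∈⁺ (inj₂ v∈⁅v⁆)
    K⊆K′ : K ⊆ K′
    K⊆K′ w k = ∈⁺ (inj₁ k)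
    K′⊆B : K′ ⊆ B
    K′⊆B w e = [ K⊆B w , (λ e′ → subst (_∈ˢ B) (≡-sym (∈⁻ e′)) (proj₁ (∈⁻ v∈))) ]′ (∈⁻ e)
    R′ : Rooted∈ G K′
    R′ = record { root = root ; root∈ = K⊆K′ root root∈ ; walks = λ w e → walks′ w (∈⁻ e) }
      where
      open Rooted∈ R
      walks′ : ∀ w → w ∈ˢ K ⊎ w ∈ˢ ⁅ v ⁆ → WalkIn G K′ w root
      walks′ w (inj₁ k) = walk-mono K⊆K′ (walks w k)
      walks′ w (inj₂ e) = subst (λ z → WalkIn G K′ z root) (≡-sym (∈⁻ e))
        (step v∈K′ (edge-sym {G} uv) (walk-mono K⊆K′ (walks u u∈K)))
    smaller : count (n G) (B ∖ K′) < count (n G) (B ∖ K)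
    smaller = count-< {P = B ∖ K′} {B ∖ K}
      (λ w e → ∈⁺ (proj₁ (∈⁻ e) , λ k → proj₂ (∈⁻ {v = w} e) (K⊆K′ w k)))
      v v∈ (λ e → proj₂ (∈⁻ {v = v} e) v∈K′)
    open Component (component i {K′} {B} (s≤s⁻¹ (<-≤-trans smaller le)) K′⊆B R′)

-- Recursion layer by layer.

module Layers (G : Graph) (N : ℕ) where

  private
    ∣_∣ : VSet G → ℕ
    ∣ A ∣ = count (n G) A

  -- `U` is to become the branch set of the apex: every branch set that meets `S` is adjacent to it.
  record Anchor (C S : VSet G) : Set where
    field
      U      : VSet G
      rooted : Rooted∈ G U
      apart  : ∀ v → v ∈ˢ U → v ∉ˢ C
      near   : ∀ s → s ∈ˢ S → ∃ λ u → u ∈ˢ U × Edge G u s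

  module _ {C S : VSet G} where

    hanging : Core (restrict G C) S N → ℕ → VSet G
    hanging D t = ⟦ (λ v → (v ∈? C) ×-dec ¬? (v ∈? Core.core D) ×-dec (Core.l D v ≟ t)) ⟧

    -- `K` will be the anchor set for the part hanging at `t`, whose neighbours in the core it
    -- contains.
    record Joined (D : Core (restrict G C) S N) (t : ℕ) : Set where
      field
        K      : VSet G
        rooted : Rooted∈ G K
        apart  : ∀ v → v ∈ˢ K → v ∉ˢ hanging D t
        core⊆K : ∀ v → v ∈ˢ C → v ∈ˢ Core.core D → v ∈ˢ K

    -- Whatever the vertices hanging at position t cut off from U can be moved to position t as well.
    module Refine (S⊆C : S ⊆ C) (anchor : Anchor C S) (D : Core (restrict G C) S N) (t : ℕ) where
      open Anchor anchor
      open Core D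

      H B : VSet G
      H = hanging D t
      B = (C ∪ U) ∖ H

      U⊆B : U ⊆ B
      U⊆B v u = ∈⁺ (v∈C∪U , λ h → apart v u (proj₁ (∈⁻ h)))
        where
        v∈C∪U : v ∈ˢ (C ∪ U)
        v∈C∪U = ∈⁺ (inj₂ u)

      comp : Component U B
      comp = component ∣ B ∖ U ∣ ≤-refl U⊆B rooted

      open Component comp using (closed) renaming (K⁺ to K; ⊆B to K⊆B; K⊆ to U⊆K; rooted to K-rooted)

      K-apart : ∀ v → v ∈ˢ K → v ∉ˢ H
      K-apart v k = proj₂ (∈⁻ (K⊆B v k))

      C∩B : ∀ v → v ∈ˢ C → v ∉ˢ H → v ∈ˢ B
      C∩B v c ¬h = ∈⁺ (v∈C∪U , ¬h)
        where
        v∈C∪U : v ∈ˢ (C ∪ U)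
        v∈C∪U = ∈⁺ (inj₁ c)

      S⊆K : S ⊆ K
      S⊆K s s∈S with near s s∈S
      ... | u , u∈U , us = closed u s (U⊆K u u∈U)
              (C∩B s (S⊆C s s∈S) (λ h → proj₁ (proj₂ (∈⁻ h)) (S⊆core s s∈S))) us

      joined : (∀ v → v ∈ˢ C → v ∈ˢ core → v ∈ˢ K) → Joined D t
      joined h = record { K = K ; rooted = K-rooted ; apart = K-apart ; core⊆K = h }

      core′ : VSet G
      core′ = core ∩ K
      l′ r′ : V G → ℕ
      l′ v = if K v then l v else t
      r′ v = if K v then r v else t

      data Place (v : V G) : Set where
        inside  : v ∈ˢ K → l′ v ≡ l v → r′ v ≡ r v → Place v
        outside : v ∉ˢ K → l′ v ≡ t → r′ v ≡ t → Place v

      place : ∀ v → Place v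
      place v with v ∈? K
      ... | yes k = inside k (if-in {A = K} k) (if-in {A = K} k)
      ... | no ¬k = outside ¬k (if-out {A = K} ¬k) (if-out {A = K} ¬k)

      -- Within `C`, only vertices of `H` are joined to `K` from outside it, and these sit at
      -- position `t` already. So moving everything outside `K` to `t` breaks no edge.
      cut-off : ∀ u v → u ∈ˢ K → v ∉ˢ K → v ∈ˢ C → Edge G u v → v ∈ˢ H
      cut-off u v k ¬k c e with v ∈? H
      ... | yes h = h
      ... | no ¬h = contradiction (closed u v k (C∩B v c ¬h) e) ¬k

      l-hanging : ∀ v → v ∈ˢ H → l v ≡ t
      l-hanging v h = proj₂ (proj₂ (∈⁻ h))

      r-hanging : ∀ v → v ∈ˢ H → r v ≡ t
      r-hanging v h = trans (thin v (proj₁ (proj₂ (∈⁻ h)))) (l-hanging v h)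

      touch′ : ∀ u v → Edge (restrict G C) u v → l′ u ≤ r′ v
      touch′ u v e with place u | place v | restrict⁻ {G} {C} {u} {v} e
      ... | inside _ el _  | inside _ _ er  | _ rewrite el | er = touch u v e
      ... | outside _ el _ | outside _ _ er | _ rewrite el | er = ≤-refl
      ... | inside k el _  | outside ¬k _ er | _ , c , uv rewrite el | er =
        ≤-trans (touch u v e) (≤-reflexive (r-hanging v (cut-off u v k ¬k c uv)))
      ... | outside ¬k el _ | inside k _ er | c , _ , uv rewrite el | er =
        ≤-trans (≤-reflexive (≡-sym (l-hanging u (cut-off v u k ¬k c (edge-sym {G} uv))))) (touch u v e)

      l≤r′ : ∀ v → l′ v ≤ r′ v
      l≤r′ v with place v
      ... | inside _ el er rewrite el | er = l≤r v
      ... | outside _ el er rewrite el | er = ≤-refl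

      r<T′ : t < T → ∀ v → r′ v < T
      r<T′ t<T v with place v
      ... | inside _ _ er rewrite er = r<T v
      ... | outside _ _ er rewrite er = t<T

      thin′ : ∀ v → v ∉ˢ core′ → r′ v ≡ l′ v
      thin′ v ¬c with place v
      ... | inside k el er = trans er (trans (thin v (λ c → ¬c (∈⁺ (c , k)))) (≡-sym el))
      ... | outside _ el er = trans er (≡-sym el)

      width-old : ∀ s v → v ∈ˢ core′ × l′ v ≤ s × s ≤ r′ v → v ∈ˢ core × l v ≤ s × s ≤ r v
      width-old s v (c , a , b) with place v
      ... | inside _ el er rewrite el | er = proj₁ (∈⁻ c) , a , b
      ... | outside ¬k _ _ = contradiction (proj₂ (∈⁻ c)) ¬k

      refined : t < T → Core (restrict G C) S N
      refined t<T = record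
        { core = core′ ; l = l′ ; r = r′ ; T = T ; l≤r = l≤r′ ; r<T = r<T′ t<T ; thin = thin′
        ; S⊆core = λ s s∈S → ∈⁺ (S⊆core s s∈S , S⊆K s s∈S) ; touch = touch′
        ; width = λ s → ≤-trans (count-mono {k = n G} (λ v e → ∈⁺ (width-old s v (∈⁻ e)))) (width s) }

      shrinks : ∀ v → v ∈ˢ core → v ∉ˢ K → ∣ core′ ∣ < ∣ core ∣
      shrinks v c ¬k = count-< (λ u e → proj₁ (∈⁻ e)) v c (λ e → ¬k (proj₂ (∈⁻ e)))

    JoinedCore : Set
    JoinedCore = Σ (Core (restrict G C) S N) λ D → ∀ t → t < Core.T D → Joined D t

    -- Each refinement removes a core vertex that is cut off from `U`, so the process stops.
    join : S ⊆ C → Anchor C S → ∀ i (D : Core (restrict G C) S N) → ∣ Core.core D ∣ ≤ i → JoinedCore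
    join S⊆C anchor i D le = choose i le (any? {Core.T D} (λ t → any? (λ v → (v ∈? C) ×-dec (v ∈? core) ×-dec ¬? (v ∈? K t))))
      where
      open Core D using (core; T)
      K : Fin T → VSet G
      K t = Component.K⁺ (Refine.comp S⊆C anchor D (Fin.toℕ t))
      choose : ∀ i → ∣ core ∣ ≤ i → Dec (∃ λ t → ∃ λ v → v ∈ˢ C × v ∈ˢ core × v ∉ˢ K t) → JoinedCore
      choose i le (no none) = D , λ t t<T → Refine.joined S⊆C anchor D t (all-in t t<T)
        where
        all-in : ∀ t → t < T → ∀ v → v ∈ˢ C → v ∈ˢ core → v ∈ˢ Component.K⁺ (Refine.comp S⊆C anchor D t)
        all-in t t<T v c d with v ∈? Component.K⁺ (Refine.comp S⊆C anchor D t)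
        ... | yes k = k
        ... | no ¬k = contradiction (Fin.fromℕ< t<T , v , c , d ,
                subst (λ z → v ∉ˢ Component.K⁺ (Refine.comp S⊆C anchor D z)) (≡-sym (toℕ-fromℕ< t<T)) ¬k) none
      choose zero le (yes (_ , v , _ , d , _)) =
        contradiction le (∈⇒count≰0 v d)
      choose (suc i) le (yes (t , v , _ , d , ¬k)) =
        join S⊆C anchor i (Refine.refined S⊆C anchor D (Fin.toℕ t) (toℕ<n t))
          (s≤s⁻¹ (<-≤-trans (Refine.shrinks S⊆C anchor D (Fin.toℕ t) v d ¬k) le))

  -- `touch` and `nearby` are one-sided; applied to both directions of an edge they make intervals
  -- overlap and layers differ by at most one.
  record Layered (C S : VSet G) : Set where
    field
      l r layer : V G → ℕ
      T         : ℕ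
      l≤r       : ∀ v → l v ≤ r v
      r<T       : ∀ v → r v < T
      touch     : ∀ u v → u ∈ˢ C → v ∈ˢ C → Edge G u v → l u ≤ r v
      nearby    : ∀ u v → u ∈ˢ C → v ∈ˢ C → Edge G u v → layer u ≤ suc (layer v)
      first     : ∀ s → s ∈ˢ S → layer s ≡ 0
      width     : ∀ t j → ∣ ⟦ (λ v → (v ∈? C) ×-dec (l v ≤? t) ×-dec (t ≤? r v) ×-dec (layer v ≟ j)) ⟧ ∣ ≤ N

  trivial : ∀ {C S} → (∀ v → v ∉ˢ C) → Layered C S
  trivial ¬c = record
    { l = λ _ → 0 ; r = λ _ → 0 ; layer = λ _ → 0 ; T = 1
    ; l≤r = λ _ → z≤n ; r<T = λ _ → s≤s z≤n ; touch = λ _ _ _ _ _ → z≤n ; nearby = λ _ _ _ _ _ → z≤n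
    ; first = λ _ _ → refl
    ; width = λ t j → ≤-trans (≤-reflexive (count-empty {k = n G} (λ v e → ¬c v (proj₁ (∈⁻ e))))) z≤n }

  frontier : ∀ {C S} → Core (restrict G C) S N → ℕ → VSet G
  frontier {C} D t = ⟦ (λ v → (v ∈? hanging D t) ×-dec
    any? (λ u → (u ∈? C) ×-dec (u ∈? Core.core D) ×-dec edge? {G} u v)) ⟧

  upper : (f : ℕ → ℕ) → ∀ T → ∃ λ M → ∀ t → t < T → f t ≤ M
  upper f zero    = 0 , λ _ ()
  upper f (suc T) with upper f T
  ... | M , h = M ⊔ f T , bound
    where
    bound : ∀ t → t < suc T → f t ≤ M ⊔ f T
    bound t t<T with t ≟ T
    ... | yes refl = m≤n⊔m M (f T)
    ... | no t≢T   = ≤-trans (h t (≤∧≢⇒< (s≤s⁻¹ t<T) t≢T)) (m≤m⊔n M (f T))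

  -- Position t of the core is blown up into the block of positions t * suc M , … , t * suc M + M, which
  -- hosts the decomposition of the part hanging there, shifted one layer down.
  module Stack {C S : VSet G} (S⊆C : S ⊆ C) (D : Core (restrict G C) S N)
               (sub : ∀ t → Layered (hanging D t) (frontier D t)) where
    private
      module D = Core D
      module L t = Layered (sub t)
    open Core D using (core)

    M : ℕ
    M = proj₁ (upper (λ t → L.T t) D.T)

    r≤M : ∀ v → L.r (D.l v) v ≤ M
    r≤M v = ≤-trans (<⇒≤ (L.r<T (D.l v) v))
      (proj₂ (upper (λ t → L.T t) D.T) (D.l v) (≤-<-trans (D.l≤r v) (D.r<T v)))

    l r layer : V G → ℕ
    l v     = if core v then D.l v * suc M else D.l v * suc M + L.l (D.l v) v
    r v     = if core v then D.r v * suc M + M else D.l v * suc M + L.r (D.l v) v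
    layer v = if core v then 0 else suc (L.layer (D.l v) v)

    data Place (v : V G) : Set where
      inside  : v ∈ˢ core → l v ≡ D.l v * suc M → r v ≡ D.r v * suc M + M → layer v ≡ 0 → Place v
      outside : v ∉ˢ core → l v ≡ D.l v * suc M + L.l (D.l v) v → r v ≡ D.l v * suc M + L.r (D.l v) v →
                layer v ≡ suc (L.layer (D.l v) v) → Place v

    place : ∀ v → Place v
    place v with v ∈? core
    ... | yes c = inside c (if-in {A = core} c) (if-in {A = core} c) (if-in {A = core} c)
    ... | no ¬c = outside ¬c (if-out {A = core} ¬c) (if-out {A = core} ¬c) (if-out {A = core} ¬c)

    hang : ∀ v → v ∈ˢ C → v ∉ˢ core → v ∈ˢ hanging D (D.l v)
    hang v c ¬c = ∈⁺ (c , ¬c , refl)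

    l≤r : ∀ v → l v ≤ r v
    l≤r v with place v
    ... | inside _ el er _ rewrite el | er = ≤-trans (*-monoˡ-≤ (suc M) (D.l≤r v)) (m≤m+n _ M)
    ... | outside _ el er _ rewrite el | er = +-monoʳ-≤ (D.l v * suc M) (L.l≤r (D.l v) v)

    block< : ∀ {t a} → t < D.T → a ≤ M → t * suc M + a < D.T * suc M
    block< {t} {a} t<T a≤M = ≤-trans (s≤s (+-monoʳ-≤ (t * suc M) a≤M))
      (≤-trans (≤-reflexive (trans (≡-sym (+-suc (t * suc M) M)) (+-comm (t * suc M) (suc M))))
        (*-monoˡ-≤ (suc M) t<T))

    r<T : ∀ v → r v < D.T * suc M
    r<T v with place v
    ... | inside _ _ er _ rewrite er = block< (D.r<T v) ≤-refl
    ... | outside _ _ er _ rewrite er = block< (≤-<-trans (D.l≤r v) (D.r<T v)) (r≤M v)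

    same-position : ∀ u v → u ∈ˢ C → v ∈ˢ C → u ∉ˢ core → v ∉ˢ core → Edge G u v → D.l u ≡ D.l v
    same-position u v c c′ ¬c ¬c′ e = ≤-antisym
      (≤-trans (D.touch u v (restrict⁺ {G} {C} c c′ e)) (≤-reflexive (D.thin v ¬c′)))
      (≤-trans (D.touch v u (restrict⁺ {G} {C} c′ c (edge-sym {G} e))) (≤-reflexive (D.thin u ¬c)))

    touch : ∀ u v → u ∈ˢ C → v ∈ˢ C → Edge G u v → l u ≤ r v
    touch u v c c′ e with place u | place v
    ... | inside _ el _ _ | inside _ _ er _ rewrite el | er =
      ≤-trans (*-monoˡ-≤ (suc M) (D.touch u v (restrict⁺ {G} {C} c c′ e))) (m≤m+n _ M)
    ... | inside _ el _ _ | outside ¬k _ er _ rewrite el | er =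
      ≤-trans (*-monoˡ-≤ (suc M) (≤-trans (D.touch u v (restrict⁺ {G} {C} c c′ e)) (≤-reflexive (D.thin v ¬k)))) (m≤m+n _ _)
    ... | outside _ el _ _ | inside _ _ er _ rewrite el | er =
      +-mono-≤ (*-monoˡ-≤ (suc M) (D.touch u v (restrict⁺ {G} {C} c c′ e))) (≤-trans (L.l≤r (D.l u) u) (r≤M u))
    ... | outside ¬k el _ _ | outside ¬k′ _ er _ rewrite el | er =
      subst (λ t → D.l u * suc M + L.l (D.l u) u ≤ t * suc M + L.r t v) same
        (+-monoʳ-≤ (D.l u * suc M) (L.touch (D.l u) u v (hang u c ¬k)
          (subst (λ t → v ∈ˢ hanging D t) (≡-sym same) (hang v c′ ¬k′)) e))
      where
      same : D.l u ≡ D.l v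
      same = same-position u v c c′ ¬k ¬k′ e

    nearby : ∀ u v → u ∈ˢ C → v ∈ˢ C → Edge G u v → layer u ≤ suc (layer v)
    nearby u v c c′ e with place u | place v
    ... | inside _ _ _ en | _ rewrite en = z≤n
    -- A hanging vertex adjacent to the core is in the frontier, hence in layer 0 of its part.
    ... | outside ¬k _ _ en | inside k _ _ en′ rewrite en | en′ = s≤s (≤-reflexive
      (L.first (D.l u) u (∈⁺ (hang u c ¬k , v , c′ , k , edge-sym {G} e))))
    ... | outside ¬k _ _ en | outside ¬k′ _ _ en′ rewrite en | en′ =
      s≤s (subst (λ t → L.layer (D.l u) u ≤ suc (L.layer t v)) same
        (L.nearby (D.l u) u v (hang u c ¬k)
          (subst (λ t → v ∈ˢ hanging D t) (≡-sym same) (hang v c′ ¬k′)) e))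
      where
      same : D.l u ≡ D.l v
      same = same-position u v c c′ ¬k ¬k′ e

    first : ∀ s → s ∈ˢ S → layer s ≡ 0
    first s s∈S = if-in {A = core} (D.S⊆core s s∈S)

    -- Blocks have length `suc M`, so division by `suc M` recovers the position in the core.
    block-≤ : ∀ {t a τ} → t * suc M + a ≤ τ → t ≤ τ / suc M
    block-≤ {t} {a} le = ≤-trans (≤-reflexive (≡-sym (m*n/n≡m t (suc M)))) (/-monoˡ-≤ (suc M) (≤-trans (m≤m+n (t * suc M) a) le))

    block-≥ : ∀ {t a τ} → τ ≤ t * suc M + a → a ≤ M → τ / suc M ≤ t
    block-≥ {t} {a} {τ} le a≤M = s≤s⁻¹ (m<n*o⇒m/o<n {τ} {suc t} {suc M}
      (≤-trans (s≤s (≤-trans le (+-monoʳ-≤ (t * suc M) a≤M)))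
        (≤-reflexive (trans (≡-sym (+-suc (t * suc M) M)) (+-comm (t * suc M) (suc M))))))

    divided : ∀ τ → (τ / suc M) * suc M + τ % suc M ≡ τ
    divided τ = trans (+-comm _ (τ % suc M)) (≡-sym (m≡m%n+[m/n]*n τ (suc M)))

    width : ∀ τ j → ∣ ⟦ (λ v → (v ∈? C) ×-dec (l v ≤? τ) ×-dec (τ ≤? r v) ×-dec (layer v ≟ j)) ⟧ ∣ ≤ N
    width τ zero = ≤-trans (count-mono {k = n G} (λ v e → ∈⁺ (at-core v (∈⁻ e)))) (D.width (τ / suc M))
      where
      at-core : ∀ v → v ∈ˢ C × l v ≤ τ × τ ≤ r v × layer v ≡ 0 →
                v ∈ˢ core × D.l v ≤ τ / suc M × τ / suc M ≤ D.r v
      at-core v (_ , a , b , z) with place v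
      ... | inside k el er _ rewrite el | er = k , block-≤ {D.l v} {0} (≤-trans (≤-reflexive (+-identityʳ _)) a) , block-≥ b ≤-refl
      ... | outside _ _ _ en = contradiction (trans (≡-sym z) en) λ ()
    -- Below the core layer, bag `τ` meets only the part hanging at `τ / suc M`, in that part's bag
    -- `τ % suc M`.
    width τ (suc j) = ≤-trans (count-mono {k = n G} (λ v e → ∈⁺ (at-sub v (∈⁻ e)))) (L.width t (τ % suc M) j)
      where
      t = τ / suc M
      at-sub : ∀ v → v ∈ˢ C × l v ≤ τ × τ ≤ r v × layer v ≡ suc j →
               v ∈ˢ hanging D t × L.l t v ≤ τ % suc M × τ % suc M ≤ L.r t v × L.layer t v ≡ j
      at-sub v (c , a , b , z) with place v
      ... | inside _ _ _ en = contradiction (trans (≡-sym z) en) λ ()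
      ... | outside ¬k el er en rewrite el | er | en = subst
        (λ t → v ∈ˢ hanging D t × L.l t v ≤ τ % suc M × τ % suc M ≤ L.r t v × L.layer t v ≡ j) same
        (hang v c ¬k ,
         +-cancelˡ-≤ (D.l v * suc M) _ _ (≤-trans a (≤-reflexive here′)) ,
         +-cancelˡ-≤ (D.l v * suc M) _ _ (≤-trans (≤-reflexive (≡-sym here′)) b) ,
         suc-injective z)
        where
        same : D.l v ≡ t
        same = ≤-antisym (block-≤ {D.l v} a) (block-≥ b (r≤M v))
        here′ : τ ≡ D.l v * suc M + τ % suc M
        here′ = trans (≡-sym (divided τ)) (cong (λ t → t * suc M + τ % suc M) (≡-sym same))

    stacked : Layered C S
    stacked = record
      { l = l ; r = r ; layer = layer ; T = D.T * suc M ; l≤r = l≤r ; r<T = r<T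
      ; touch = touch ; nearby = nearby ; first = first ; width = width }

  module _ (1≤N : 1 ≤ N)
           (core : ∀ {C S} → S ⊆ C → Anchor C S → Core (restrict G C) S N) where

    Started : (C S : VSet G) → Set
    Started C S = Σ (JoinedCore {C} {S}) λ J → ∃ λ v → v ∈ˢ C × v ∈ˢ Core.core (proj₁ J)

    -- The core must contain a vertex of `C` for the recursion to descend. If `S` is empty, one
    -- arbitrary vertex forms the core and is itself the connected set `K`.
    start : ∀ {C S} → ∃ (_∈ˢ C) → S ⊆ C → (∀ v → v ∉ˢ S) ⊎ Anchor C S → Started C S
    start {C} {S} _ S⊆C anchor with any? (_∈? S)
    start {C} {S} _ S⊆C (inj₁ S=∅) | yes (s , s∈S) = contradiction s∈S (S=∅ s)
    start {C} {S} _ S⊆C (inj₂ anchor) | yes (s , s∈S) =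
      J , s , S⊆C s s∈S , Core.S⊆core (proj₁ J) s s∈S
      where
      J : JoinedCore {C} {S}
      J = join S⊆C anchor ∣ Core.core (core S⊆C anchor) ∣ (core S⊆C anchor) ≤-refl
    start {C} {S} (x , x∈C) S⊆C anchor | no S=∅ = (D , λ t _ → joined t) , x , x∈C , x∈⁅x⁆
      where
      x∈⁅x⁆ : x ∈ˢ ⁅ x ⁆
      x∈⁅x⁆ = ∈⁺ refl
      D : Core (restrict G C) S N
      D = record
        { core = ⁅ x ⁆ ; l = λ _ → 0 ; r = λ _ → 0 ; T = 1
        ; l≤r = λ _ → z≤n ; r<T = λ _ → s≤s z≤n ; thin = λ _ _ → refl
        ; S⊆core = λ s s∈S → contradiction (s , s∈S) S=∅ ; touch = λ _ _ _ → z≤n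
        ; width = λ t → ≤-trans (count-mono {k = n G} (λ v e → proj₁ (∈⁻ e))) (≤-trans (≤-reflexive (count-⁅⁆ x)) 1≤N) }
      joined : ∀ t → Joined D t
      joined t = record
        { K = ⁅ x ⁆
        ; rooted = record { root = x ; root∈ = x∈⁅x⁆
                          ; walks = λ v e → subst (λ z → WalkIn G ⁅ x ⁆ z x) (≡-sym (∈⁻ e)) (here x∈⁅x⁆) }
        ; apart = λ v e h → proj₁ (proj₂ (∈⁻ h)) e
        ; core⊆K = λ v _ e → e }

    -- Induction on the size of `C`: hanging parts miss a core vertex, and the sets `K` of `Joined`
    -- anchor their frontiers.
    layered : ∀ i {C S} → ∣ C ∣ ≤ i → S ⊆ C → (∀ v → v ∉ˢ S) ⊎ Anchor C S → Layered C S
    layered i {C} {S} C≤i S⊆C anchor with any? (_∈? C)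
    ... | no C=∅ = trivial (λ v c → C=∅ (v , c))
    layered zero {C} {S} C≤i S⊆C anchor | yes (x , x∈C) =
      contradiction C≤i (∈⇒count≰0 x x∈C)
    layered (suc i) {C} {S} C≤i S⊆C anchor | yes C≠∅ = combine (start C≠∅ S⊆C anchor)
      where
      combine : Started C S → Layered C S
      combine ((D , joined) , x , x∈C , x∈core) = Stack.stacked S⊆C D sub
        where
        frontier⊆ : ∀ t → frontier D t ⊆ hanging D t
        frontier⊆ t v e = proj₁ (∈⁻ e)
        smaller : ∀ t → ∣ hanging D t ∣ ≤ i
        smaller t = s≤s⁻¹ (<-≤-trans (count-< (λ v e → proj₁ (∈⁻ e)) x x∈C (λ e → proj₁ (proj₂ (∈⁻ e)) x∈core)) C≤i)
        anchor′ : ∀ {t} → Joined D t → Anchor (hanging D t) (frontier D t)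
        anchor′ {t} J = record { U = K ; rooted = rooted ; apart = apart ; near = λ s e → near s (proj₂ (∈⁻ e)) }
          where
          open Joined J
          near : ∀ s → (∃ λ u → u ∈ˢ C × u ∈ˢ Core.core D × Edge G u s) → ∃ λ u → u ∈ˢ K × Edge G u s
          near s (u , c , k , e) = u , core⊆K u c k , e
        sub : ∀ t → Layered (hanging D t) (frontier D t)
        sub t with t <? Core.T D
        ... | yes t<T = layered i (smaller t) (frontier⊆ t) (inj₂ (anchor′ (joined t t<T)))
        ... | no t≮T = trivial (λ v e → t≮T (subst (_< Core.T D) (proj₂ (proj₂ (∈⁻ e)))
                          (≤-<-trans (Core.l≤r D v) (Core.r<T D v))))

-- Leaves of forests.

module _ {X : Graph} where

  -- Where every vertex of R has two neighbours in R, a walk in R that never turns back closes up to a cycle.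
  module NonBacktracking {R : VSet X}
      (next : ∀ p x → x ∈ˢ R → ∃ λ w → w ∈ˢ R × Edge X x w × w ≢ p) (x₀ : V X) (x₀∈R : x₀ ∈ˢ R) where

    state : ℕ → Σ (V X × V X) λ px → proj₂ px ∈ˢ R
    -- The start has no predecessor; `x₀` stands in and excludes nothing, being no neighbour of
    -- itself.
    state zero = (x₀ , x₀) , x₀∈R
    state (suc i) with state i
    ... | (p , x) , x∈R = (x , proj₁ (next p x x∈R)) , proj₁ (proj₂ (next p x x∈R))

    f : ℕ → V X
    f i = proj₂ (proj₁ (state i))

    f∈R : ∀ i → f i ∈ˢ R
    f∈R i = proj₂ (state i)

    f-edge : ∀ i → Edge X (f i) (f (suc i))
    f-edge i with state i
    ... | (p , x) , x∈R = proj₁ (proj₂ (proj₂ (next p x x∈R)))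

    f-turn : ∀ i → f (2 + i) ≢ f i
    f-turn i with state i
    ... | (p , x) , x∈R with next p x x∈R
    ...   | w , w∈R , _ = proj₂ (proj₂ (proj₂ (next x w w∈R)))

    Loop : ℕ → ℕ → Set
    Loop i d = f i ≡ f (i + suc d)

    Clean : ℕ → ℕ → Set
    Clean i d = ∀ (s t : Fin (suc d)) → f (i + Fin.toℕ s) ≡ f (i + Fin.toℕ t) → s ≡ t

    -- A repetition inside a loop is a shorter loop, so descent on `d` ends at one with distinct
    -- vertices.
    shortest : ∀ k i d → d ≤ k → Loop i d → ∃ λ i → ∃ λ d → Loop i d × Clean i d
    shortest k i d d≤k loop with any? {suc d} (λ s → any? {suc d} (λ t →
      (Fin.toℕ s <? Fin.toℕ t) ×-dec (f (i + Fin.toℕ s) Fin.≟ f (i + Fin.toℕ t))))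
    ... | no none = i , d , loop , clean
      where
      clean : Clean i d
      clean s t e with <-cmp (Fin.toℕ s) (Fin.toℕ t)
      ... | tri< s<t _ _ = contradiction (s , t , s<t , e) none
      ... | tri≈ _ s≡t _ = toℕ-injective s≡t
      ... | tri> _ _ t<s = contradiction (t , s , t<s , ≡-sym e) none
    ... | yes (s , t , s<t , e) with m≤n⇒∃[o]m+o≡n s<t
    ...   | d′ , eq = descend k d≤k
      where
      loop′ : Loop (i + Fin.toℕ s) d′
      loop′ = trans e (cong f (trans (cong (i +_) (trans (≡-sym eq) (≡-sym (+-suc (Fin.toℕ s) d′))))
                                     (≡-sym (+-assoc i (Fin.toℕ s) (suc d′)))))
      d′<d : d′ < d
      d′<d = ≤-trans (s≤s (m≤n+m d′ (Fin.toℕ s))) (≤-trans (≤-reflexive eq) (s≤s⁻¹ (toℕ<n t)))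
      descend : ∀ k → d ≤ k → ∃ λ i → ∃ λ d → Loop i d × Clean i d
      descend zero    d≤k = contradiction (<-≤-trans d′<d d≤k) λ ()
      descend (suc k) d≤k = shortest k (i + Fin.toℕ s) d′ (s≤s⁻¹ (<-≤-trans d′<d d≤k)) loop′

    cycle-of : ∀ i d → Loop i d → Clean i d → Σ (Cycle X) λ C → ∀ t → c C t ∈ˢ R
    cycle-of i zero loop _ = contradiction
      (trans (≡-sym (f-edge i)) (trans (cong (adj X (f i)) (≡-sym (trans loop (cong f (+-comm i 1))))) (irrefl X (f i))))
      λ ()
    -- A loop of two edges would turn back; the previous case was a loop of one edge.
    cycle-of i (suc zero) loop _ = contradiction (≡-sym (trans loop (cong f (+-comm i 2)))) (f-turn i)
    cycle-of i (suc (suc k)) loop clean = record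
      { len = k ; c = λ t → f (i + Fin.toℕ t) ; inj = λ {s} {t} e → clean s t e
      ; consec = λ t → subst₂ (λ a b → Edge X (f (i + a)) (f b)) (≡-sym (toℕ-inject₁ t)) (≡-sym (+-suc i (Fin.toℕ t)))
                         (f-edge (i + Fin.toℕ t))
      ; close = subst₂ (Edge X) (cong (λ a → f (i + a)) (≡-sym (toℕ-fromℕ (2 + k))))
                  (trans (cong f (≡-sym (+-suc i (2 + k)))) (trans (≡-sym loop) (cong f (≡-sym (+-identityʳ i)))))
                  (f-edge (i + (2 + k)))
      } , λ t → f∈R (i + Fin.toℕ t)

    closed-walk : Σ (Cycle X) λ C → ∀ t → c C t ∈ˢ R
    closed-walk with pigeonhole (n<1+n (n X)) (λ i → f (Fin.toℕ i))
    ... | i , j , i<j , e with m≤n⇒∃[o]m+o≡n i<j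
    ...   | d , eq with shortest d (Fin.toℕ i) d ≤-refl (trans e (cong f (trans (≡-sym eq) (≡-sym (+-suc _ d)))))
    ...     | i′ , d′ , loop , clean = cycle-of i′ d′ loop clean

  -- Without a leaf, every vertex of `R` can be left by an edge of X[R] other than the one used to
  -- enter it, and the resulting cycle avoids `a`.
  leaf-exists : ∀ {a} → AcyclicAfterDeleting X a → ∀ R → (∀ x → x ∈ˢ R → just x ≢ a) →
                ∃ (_∈ˢ R) → ∃ (Leaf X R)
  leaf-exists acyclic R avoid (x₀ , x₀∈R) with any? (λ x → (x ∈? R) ×-dec
    all? (λ y → all? (λ z → (y ∈? R) →-dec (z ∈? R) →-dec edge? {X} x y →-dec edge? {X} x z →-dec (y Fin.≟ z))))
  ... | yes (x , l) = x , l
  ... | no none = contradiction (proj₁ cycle , λ t → avoid _ (proj₂ cycle t)) acyclic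
    where
    next : ∀ p x → x ∈ˢ R → ∃ λ w → w ∈ˢ R × Edge X x w × w ≢ p
    next p x x∈R with any? (λ w → (w ∈? R) ×-dec edge? {X} x w ×-dec ¬? (w Fin.≟ p))
    ... | yes w = w
    ... | no ¬w = contradiction (x , x∈R , λ y z y∈ z∈ xy xz → trans (is-p y y∈ xy) (≡-sym (is-p z z∈ xz))) none
      where
      is-p : ∀ y → y ∈ˢ R → Edge X x y → y ≡ p
      is-p y y∈ xy with y Fin.≟ p
      ... | yes e = e
      ... | no y≢p = contradiction (y , y∈ , xy , y≢p) ¬w
    cycle = NonBacktracking.closed-walk next x₀ x₀∈R

-- The model of `X`.

module _ {X G : Graph} (apex : V X) {N : ℕ} {C S : VSet G} where
  open Layers G N using (Anchor)

  -- `U` represents the apex. Every other branch set meets `S` and is therefore adjacent to `U`,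
  -- which realises any edge at the apex.
  full-model : S ⊆ C → Anchor C S → PartialModel X (restrict G C) (⊤ˢ ∖ ⁅ apex ⁆) S ⊤ˢ → Model X G
  full-model S⊆C anchor M = record { B = B ; disjoint = disjoint ; connected = conn′ ; edges = edges }
    where
    open Anchor anchor
    open PartialModel M
    B : V X → VSet G
    B x with x Fin.≟ apex
    ... | yes _ = U
    ... | no  _ = fib {G = G} col x
    other : ∀ {x} → x ≢ apex → x ∈ˢ (⊤ˢ ∖ ⁅ apex ⁆)
    other x≢ = ∈⁺ (refl , λ e → x≢ (∈⁻ e))
    rep : ∀ x → x ≢ apex → ∃ λ w → w ∈ˢ S × col w ≡ just x
    rep x x≢ = meets x (other x≢)
    walk-C : ∀ {A u v} → WalkIn (restrict G C) A u v → v ∈ˢ C → u ∈ˢ C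
    walk-C (here _) v∈C = v∈C
    walk-C (step _ e _) _ = proj₁ (restrict⁻ {G} {C} e)
    -- A branch set is connected in the restricted graph and contains a vertex of `S`, so it cannot
    -- leave `C`; hence it avoids `U`.
    col⊆C : ∀ g x → x ≢ apex → col g ≡ just x → g ∈ˢ C
    col⊆C g x x≢ e with rep x x≢
    ... | w , w∈S , e′ = walk-C (conn g w x e e′) (S⊆C w w∈S)
    disjoint : ∀ x y g → g ∈ˢ B x → g ∈ˢ B y → x ≡ y
    disjoint x y g p q with x Fin.≟ apex | y Fin.≟ apex
    ... | yes e | yes e′ = trans e (≡-sym e′)
    ... | yes _ | no y≢ = contradiction (col⊆C g y y≢ (∈⁻ q)) (apart g p)
    ... | no x≢ | yes _ = contradiction (col⊆C g x x≢ (∈⁻ p)) (apart g q)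
    ... | no _  | no _  = just-injective (trans (≡-sym (∈⁻ p)) (∈⁻ q))
    conn′ : ∀ x → NonEmptyConnected G (B x)
    conn′ x with x Fin.≟ apex
    ... | yes _ = Rooted∈.connected rooted
    ... | no x≢ = (proj₁ (rep x x≢) , ∈⁺ (proj₂ (proj₂ (rep x x≢)))) ,
                  λ u v p q → walk-mono (λ w e → ∈⁺ (∈⁻ e)) (unrestrict-walk (conn u v x (∈⁻ p) (∈⁻ q)))
    edges : ∀ x y → Edge X x y → ∃ λ g → ∃ λ h → g ∈ˢ B x × h ∈ˢ B y × Edge G g h
    edges x y xy with x Fin.≟ apex | y Fin.≟ apex
    ... | yes refl | yes refl = contradiction (trans (≡-sym xy) (irrefl X x)) λ ()
    ... | yes _ | no y≢ with rep y y≢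
    ...   | w , w∈S , e with near w w∈S
    ...     | u , u∈U , uw = u , w , u∈U , ∈⁺ e , uw
    edges x y xy | no x≢ | yes _ with rep x x≢
    ...   | w , w∈S , e with near w w∈S
    ...     | u , u∈U , uw = w , u , ∈⁺ e , u∈U , edge-sym {G} uw
    edges x y xy | no x≢ | no y≢ with links x y (other x≢) (other y≢) xy
    ...   | g , h , e , e′ , gh = g , h , ∈⁺ e , ∈⁺ e′ , proj₂ (proj₂ (restrict⁻ {G} {C} gh))

-- Reading off the path decomposition and the layering.

module _ {G : Graph} {N : ℕ} (D : Layers.Layered G N ⊤ˢ ∅ˢ) where
  open Layers.Layered D

  path-decomposition : PathDecomposition G
  path-decomposition = record
    -- One extra bag, which is empty, ensures that there is a bag even if `T` is 0.
    { m = suc T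
    ; m≥1 = s≤s z≤n
    ; W = λ i v → ⟦ (λ v → (l v ≤? Fin.toℕ i) ×-dec (Fin.toℕ i ≤? r v)) ⟧ v
    -- The later of the two left ends lies in both intervals.
    ; edgeCov = λ u v e → at (l u ⊔ l v) (≤-trans (⊔-lub (l≤r u) (touch v u refl refl (edge-sym {G} e))) (<⇒≤ (r<T u)))
        u v (m≤m⊔n _ _) (⊔-lub (l≤r u) (touch v u refl refl (edge-sym {G} e)))
            (m≤n⊔m (l u) _) (⊔-lub (touch u v refl refl e) (l≤r v))
    ; nonempty = λ v → at′ v
    ; interval = λ v i j k i≤j j≤k e e′ → ∈⁺ (≤-trans (proj₁ (∈⁻ e)) i≤j , ≤-trans j≤k (proj₂ (∈⁻ e′))) }
    where
    bag : Fin (suc T) → VSet G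
    bag i = ⟦ (λ v → (l v ≤? Fin.toℕ i) ×-dec (Fin.toℕ i ≤? r v)) ⟧
    at : ∀ t → t ≤ T → ∀ u v → l u ≤ t → t ≤ r u → l v ≤ t → t ≤ r v → ∃ λ i → u ∈ˢ bag i × v ∈ˢ bag i
    at t t≤T u v a b a′ b′ = Fin.fromℕ< (s≤s t≤T) , ∈⁺ (shift u a b) , ∈⁺ (shift v a′ b′)
      where
      shift : ∀ w → l w ≤ t → t ≤ r w → l w ≤ Fin.toℕ (Fin.fromℕ< (s≤s t≤T)) × Fin.toℕ (Fin.fromℕ< (s≤s t≤T)) ≤ r w
      shift w a b = subst (λ t → l w ≤ t × t ≤ r w) (≡-sym (toℕ-fromℕ< (s≤s t≤T))) (a , b)
    at′ : ∀ v → ∃ λ i → v ∈ˢ bag i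
    at′ v with at (l v) (≤-trans (l≤r v) (<⇒≤ (r<T v))) v v ≤-refl (l≤r v) ≤-refl (l≤r v)
    ... | i , p , _ = i , p

  layering : Layering G
  layering = record
    { L = L′
    ; layersDisjoint = λ i j v e e′ → trans (≡-sym (∈⁻ e)) (∈⁻ e′)
    ; cover = λ v → layer v , ∈⁺ refl
    ; layerEdges = λ u v e → pair u v (≤-total (layer u) (layer v)) e }
    where
    L′ : ℕ → VSet G
    L′ j = ⟦ (λ v → layer v ≟ j) ⟧
    either : ∀ i v → layer v ≡ i ⊎ layer v ≡ suc i → (L′ i v ∨ L′ (suc i) v) ≡ true
    either i v (inj₁ e) = cong (_∨ L′ (suc i) v) (∈⁺ {A? = λ v → layer v ≟ i} {v} e)
    either i v (inj₂ e) = trans (cong (L′ i v ∨_) (∈⁺ {A? = λ v → layer v ≟ suc i} {v} e)) (∨-zeroʳ (L′ i v))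
    above : ∀ i v → i ≤ layer v → layer v ≤ suc i → layer v ≡ i ⊎ layer v ≡ suc i
    above i v lo hi with m≤n⇒m<n∨m≡n hi
    ... | inj₁ lt = inj₁ (≤-antisym (s≤s⁻¹ lt) lo)
    ... | inj₂ e  = inj₂ e
    pair : ∀ u v → layer u ≤ layer v ⊎ layer v ≤ layer u → Edge G u v →
           ∃ λ i → (L′ i u ∨ L′ (suc i) u) ≡ true × (L′ i v ∨ L′ (suc i) v) ≡ true
    pair u v (inj₁ le) e = layer u , either _ u (inj₁ refl) ,
      either _ v (above _ v le (nearby v u refl refl (edge-sym {G} e)))
    pair u v (inj₂ le) e = layer v , either _ u (above _ u le (nearby u v refl refl e)) , either _ v (inj₁ refl)

  layered⇒lpw : LayeredPathwidth≤ G N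
  layered⇒lpw = path-decomposition , layering ,
    λ i j → ≤-trans (count-mono {k = n G} (λ v e → ∈⁺ (split v (∧-conicalˡ _ _ e) (∧-conicalʳ _ _ e)))) (width (Fin.toℕ i) j)
    where
    split : ∀ {i j} v → v ∈ˢ W path-decomposition i → v ∈ˢ L layering j →
            v ∈ˢ ⊤ˢ × l v ≤ Fin.toℕ i × Fin.toℕ i ≤ r v × layer v ≡ j
    split v e e′ = refl , proj₁ (∈⁻ e) , proj₂ (∈⁻ e) , ∈⁻ e′

-- Choice of the apex and conclusion.

-- If nothing has to be deleted, any vertex can serve as the apex.
apex-vertex : ∀ {k} (a : Maybe (Fin k)) → 2 ≤ k → ∃ λ b → ∀ x → x ≢ b → just x ≢ a
apex-vertex (just b) _             = b , λ x x≢b e → x≢b (just-injective e)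
apex-vertex nothing  (s≤s (s≤s _)) = zero , λ _ _ ()

2[2+m]∸3 : ∀ m → 2 * (2 + m) ∸ 3 ≡ suc (m + m)
2[2+m]∸3 m = cong (_∸ 3) (trans (*-distribˡ-+ 2 2 m) (cong (λ z → 4 + (m + z)) (+-identityʳ m)))

theorem1p1 : (X G : Graph) → IsApexForest X → 2 ≤ n X →
    MinorFree X G → LayeredPathwidth≤ G (2 * n X ∸ 3)
theorem1p1 X G (a , acyclic) 2≤X minor-free =
  -- The recursion starts from the whole graph with `S` empty, where there is no anchor yet.
  layered⇒lpw (layered (≤-trans (s≤s z≤n) k≤N) core (n G) (count≤k ⊤ˢ) (λ _ ()) (inj₁ (λ _ ())))
  where
  N : ℕ
  N = 2 * n X ∸ 3
  open Layers G N
  apex : V X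
  apex = proj₁ (apex-vertex a 2≤X)
  F : VSet X
  F = ⊤ˢ ∖ ⁅ apex ⁆
  m₀ : ∃ λ m → 2 + m ≡ n X
  m₀ = m≤n⇒∃[o]m+o≡n 2≤X
  -- `k` is the order of `X` minus one, the size of `F`, and `N` equals 2`k` - 1.
  k : ℕ
  k = suc (proj₁ m₀)
  N≡ : N ≡ suc (proj₁ m₀ + proj₁ m₀)
  N≡ = trans (cong (λ z → 2 * z ∸ 3) (≡-sym (proj₂ m₀))) (2[2+m]∸3 (proj₁ m₀))
  k≤N : k ≤ N
  k≤N = ≤-trans (s≤s (m≤m+n _ _)) (≤-reflexive (≡-sym N≡))
  2k≤1+N : k + k ≤ suc N
  2k≤1+N = ≤-reflexive (cong suc (trans (+-suc (proj₁ m₀) (proj₁ m₀)) (≡-sym N≡)))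
  F≤k : count (n X) F ≤ k
  F≤k = s≤s⁻¹ (<-≤-trans (count-< {Q = ⊤ˢ} (λ _ _ → refl) apex refl apex∉F)
    (≤-reflexive (trans (count-⊤ (n X)) (≡-sym (proj₂ m₀)))))
    where
    apex∉F : apex ∉ˢ F
    apex∉F e = proj₂ (∈⁻ {v = apex} e) (∈⁺ refl)
  leaf : ∀ R → R ⊆ F → ∃ (_∈ˢ R) → ∃ (Leaf X R)
  leaf R R⊆F = leaf-exists acyclic R
    (λ x x∈R → proj₂ (apex-vertex a 2≤X) x (λ e → proj₂ (∈⁻ {v = x} (R⊆F x x∈R)) (∈⁺ e)))
  core : ∀ {C S} → S ⊆ C → Anchor C S → Core (restrict G C) S N
  core {C} {S} S⊆C anchor with Sweep.good? (restrict G C) S N ⊤ˢ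
  ... | yes good = good⇒core good
  -- If the sweep cannot be completed, the rooted model of `F` and the anchor give a model of `X`.
  ... | no ¬good = contradiction (full-model apex S⊆C anchor
          (Rooted.rooted-model F leaf k N F≤k k≤N 2k≤1+N (restrict G C) S ¬good)) minor-free
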